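{- For every integer $k\ge1$ and every $s=1,\dots,k$, $$C_{\underbrace{0,\dots,0}_{s-1},1}^{s,1,k+1}=\binom{k+1}{s+1}.$$
   Context: For integers $k\ge1$, $1\le s\le k-1$, $1\le m\le s$ and nonnegative integers $\alpha_1,\dots,\alpha_s$ with $\sum_{i=1}^s\alpha_i=m$, $\sum_{i=1}^s i\alpha_i=s$, the numbers $C_{\alpha_1,\dots,\alpha_s}^{s,m,k}$ are the uniquely determined universal numbers (not depending on $u$) such that for every entire or meromorphic function $u$ on $\mathbb{C}$ the operator $A=u(z)\frac{d}{dz}$ satisfies $$A^{k}=u^k\Big(\frac{d}{dz}\Big)^k+\sum_{s=1}^{k-1}\Big(\sum_{m=1}^{s}u^{k-m}\sum_{m,s}C_{\alpha_1,\dots,\alpha_s}^{s,m,k}\Big(\frac{du}{dz}\Big)^{\alpha_1}\cdots\Big(\frac{d^su}{dz^s}\Big)^{\alpha_s}\Big)\Big(\frac{d}{dz}\Big)^{k-s},$$ where $\sum_{m,s}$ is over all nonnegative integers $\alpha_1,\dots,\alpha_s$ with $\sum_{i=1}^s\alpha_i=m$ and $\sum_{i=1}^s i\alpha_i=s$. -}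

module Defs where

open import Level using (0ℓ)
open import Algebra.Bundles using (CommutativeRing; Semiring)
import Algebra.Definitions.RawSemiring as RawSemiringDefs
open import Data.Nat.Base as ℕ using (ℕ; zero; suc)
import Data.Nat.Properties as ℕ
open import Data.Rational.Base as ℚ using (ℚ; 0ℚ; 1ℚ; ½)
import Data.Rational.Properties as ℚ
import Data.Rational.Solver as ℚ-Solver
open import Data.Nat.GeneralisedArithmetic using (fold)
open import Data.Fin.Base using (toℕ)
open import Data.List.Base using (List; []; _∷_; [_]; map; filter; foldr; upTo; applyUpTo; cartesianProductWith)
open import Data.List.Relation.Unary.All using (All)
open import Data.Vec.Base as Vec using (Vec; []; _∷_)
open import Data.Product.Base using (Σ-syntax; ∃-syntax; _×_; _,_; proj₁; proj₂)
open import Data.Sum.Base using (inj₁; inj₂)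
open import Data.Unit.Base using (⊤)
open import Relation.Nullary.Decidable using (_×-dec_)
open import Relation.Binary.PropositionalEquality as ≡ using (_≡_; refl; cong; cong₂)

module _ where
  open ℚ-Solver.+-*-Solver

  half+half : ∀ ε → ½ ℚ.* ε ℚ.+ ½ ℚ.* ε ≡ ε
  half+half ε = ≡.trans (≡.sym (ℚ.*-distribʳ-+ ε ½ ½)) (ℚ.*-identityˡ ε)

  *-pos : ∀ {p q} → 0ℚ ℚ.< p → 0ℚ ℚ.< q → 0ℚ ℚ.< p ℚ.* q
  *-pos {p} {q} 0<p 0<q =
    ℚ.positive⁻¹ (p ℚ.* q)
      {{ℚ.pos*pos⇒pos p {{ℚ.positive 0<p}} q {{ℚ.positive 0<q}}}}

  *-nonneg : ∀ {p q} → 0ℚ ℚ.≤ p → 0ℚ ℚ.≤ q → 0ℚ ℚ.≤ p ℚ.* q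
  *-nonneg {p} {q} 0≤p 0≤q =
    ℚ.nonNegative⁻¹ (p ℚ.* q)
      {{ℚ.nonNeg*nonNeg⇒nonNeg p {{ℚ.nonNegative 0≤p}} q {{ℚ.nonNegative 0≤q}}}}

  +-nonneg : ∀ {p q} → 0ℚ ℚ.≤ p → 0ℚ ℚ.≤ q → 0ℚ ℚ.≤ p ℚ.+ q
  +-nonneg 0≤p 0≤q = ℚ.+-mono-≤ 0≤p 0≤q

  half-pos : ∀ {ε} → 0ℚ ℚ.< ε → 0ℚ ℚ.< ½ ℚ.* ε
  half-pos = *-pos (ℚ.positive⁻¹ ½)

  *-mono-≤ : ∀ {p q r s} → 0ℚ ℚ.≤ p → 0ℚ ℚ.≤ s → p ℚ.≤ q → r ℚ.≤ s → p ℚ.* r ℚ.≤ q ℚ.* s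
  *-mono-≤ {p} {q} {r} {s} 0≤p 0≤s p≤q r≤s = ℚ.≤-trans
    (ℚ.*-monoˡ-≤-nonNeg p {{ℚ.nonNegative 0≤p}} r≤s)
    (ℚ.*-monoʳ-≤-nonNeg s {{ℚ.nonNegative 0≤s}} p≤q)

  square-mono : ∀ {p q} → 0ℚ ℚ.≤ p → p ℚ.≤ q → p ℚ.* p ℚ.≤ q ℚ.* q
  square-mono 0≤p p≤q = *-mono-≤ 0≤p (ℚ.≤-trans 0≤p p≤q) p≤q p≤q

  square-nonneg : ∀ p → 0ℚ ℚ.≤ p ℚ.* p
  square-nonneg p = ≡.subst (0ℚ ℚ.≤_) (∣p∣² p) (*-nonneg (ℚ.0≤∣p∣ p) (ℚ.0≤∣p∣ p))
    where

    ∣p∣² : ∀ p → ℚ.∣ p ∣ ℚ.* ℚ.∣ p ∣ ≡ p ℚ.* p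
    ∣p∣² p with ℚ.∣p∣≡p∨∣p∣≡-p p
    ... | inj₁ eq = cong₂ ℚ._*_ eq eq
    ... | inj₂ eq = ≡.trans (cong₂ ℚ._*_ eq eq)
                      (solve 1 (λ x → (:- x) :* (:- x) := x :* x) refl p)

  shrink : ∀ B ε → 0ℚ ℚ.≤ B → 0ℚ ℚ.< ε → ∃[ δ ] (0ℚ ℚ.< δ × B ℚ.* δ ℚ.≤ ε)
  shrink B ε 0≤B 0<ε = δ , 0<δ , ≡.subst (B ℚ.* δ ℚ.≤_) eq
      (ℚ.*-monoʳ-≤-nonNeg δ {{ℚ.nonNegative (ℚ.<⇒≤ 0<δ)}} B≤1+B)
    where
    B≤1+B : B ℚ.≤ 1ℚ ℚ.+ B
    B≤1+B = ≡.subst (ℚ._≤ 1ℚ ℚ.+ B) (ℚ.+-identityˡ B)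
              (ℚ.+-monoˡ-≤ B (ℚ.nonNegative⁻¹ 1ℚ))
    instance
      pos : ℚ.Positive (1ℚ ℚ.+ B)
      pos = ℚ.positive (ℚ.+-mono-<-≤ (ℚ.positive⁻¹ 1ℚ) 0≤B)
      nz : ℚ.NonZero (1ℚ ℚ.+ B)
      nz = ℚ.pos⇒nonZero (1ℚ ℚ.+ B)
    δ = ε ℚ.* (ℚ.1/ (1ℚ ℚ.+ B))
    0<δ : 0ℚ ℚ.< δ
    0<δ = *-pos 0<ε (ℚ.positive⁻¹ (ℚ.1/ (1ℚ ℚ.+ B)) {{ℚ.1/pos⇒pos (1ℚ ℚ.+ B)}})
    eq : (1ℚ ℚ.+ B) ℚ.* δ ≡ ε
    eq = ≡.trans (solve 3 (λ a e i → a :* (e :* i) := e :* (a :* i)) refl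
                   (1ℚ ℚ.+ B) ε (ℚ.1/ (1ℚ ℚ.+ B)))
           (≡.trans (cong (ε ℚ.*_) (ℚ.*-inverseʳ (1ℚ ℚ.+ B))) (ℚ.*-identityʳ ε))

Eventually : (ℕ → Set) → Set
Eventually P = ∃[ N ] ∀ n → N ℕ.≤ n → P n

ev-map₂ : ∀ {P Q R : ℕ → Set} → (∀ n → P n → Q n → R n) →
          Eventually P → Eventually Q → Eventually R
ev-map₂ f (M , p) (N , q) = M ℕ.⊔ N , λ n M⊔N≤n →
  f n (p n (ℕ.≤-trans (ℕ.m≤m⊔n M N) M⊔N≤n)) (q n (ℕ.≤-trans (ℕ.m≤n⊔m M N) M⊔N≤n))

ev-map : ∀ {P Q : ℕ → Set} → (∀ n → P n → Q n) → Eventually P → Eventually Q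
ev-map f (M , p) = M , λ n M≤n → f n (p n M≤n)

ev-always : ∀ {P : ℕ → Set} → (∀ n → P n) → Eventually P
ev-always p = 0 , λ n _ → p n

Cauchy : (ℕ → ℚ) → Set
Cauchy x = ∀ ε → 0ℚ ℚ.< ε →
  ∃[ N ] ∀ m n → N ℕ.≤ m → N ℕ.≤ n → ℚ.∣ x m ℚ.- x n ∣ ℚ.≤ ε

-- Cauchy sequences of rationals, compared by the setoid equality Real._≈_ below.
record ℝ : Set where
  constructor mkℝ
  field
    seq    : ℕ → ℚ
    cauchy : Cauchy seq
open ℝ public

module Real where

  infix 4 _≈_ _≤_
  infixl 6 _+_
  infixl 7 _*_
  infix  8 -_

  -- The relations are records rather than functions so that x and y can be
  -- inferred from a proof.
  record _≈_ (x y : ℝ) : Set where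
    constructor mk≈
    field
      close : ∀ ε → 0ℚ ℚ.< ε → Eventually λ n → ℚ.∣ seq x n ℚ.- seq y n ∣ ℚ.≤ ε
  open _≈_ public

  record _≤_ (x y : ℝ) : Set where
    constructor mk≤
    field
      below : ∀ ε → 0ℚ ℚ.< ε → Eventually λ n → seq x n ℚ.≤ seq y n ℚ.+ ε
  open _≤_ public

  private
    module _ where
      open ℚ-Solver.+-*-Solver

      ∣p-p∣≤ε : ∀ p {ε} → 0ℚ ℚ.< ε → ℚ.∣ p ℚ.- p ∣ ℚ.≤ ε
      ∣p-p∣≤ε p 0<ε = ≡.subst (ℚ._≤ _) (≡.sym (cong ℚ.∣_∣ (ℚ.+-inverseʳ p))) (ℚ.<⇒≤ 0<ε)

      ∣-∣-sym : ∀ p q → ℚ.∣ p ℚ.- q ∣ ≡ ℚ.∣ q ℚ.- p ∣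
      ∣-∣-sym p q = ≡.trans (≡.sym (ℚ.∣-p∣≡∣p∣ (p ℚ.- q)))
        (cong ℚ.∣_∣ (solve 2 (λ p q → :- (p :- q) := q :- p) refl p q))

      halves : ∀ {a b ε} → a ℚ.≤ ½ ℚ.* ε → b ℚ.≤ ½ ℚ.* ε → a ℚ.+ b ℚ.≤ ε
      halves {a} {b} {ε} a≤ b≤ = ≡.subst (a ℚ.+ b ℚ.≤_) (half+half ε) (ℚ.+-mono-≤ a≤ b≤)

      triangle : ∀ p q r {ε} → ℚ.∣ p ℚ.- q ∣ ℚ.≤ ½ ℚ.* ε → ℚ.∣ q ℚ.- r ∣ ℚ.≤ ½ ℚ.* ε →
                 ℚ.∣ p ℚ.- r ∣ ℚ.≤ ε
      triangle p q r {ε} h₁ h₂ =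
        ≡.subst (λ t → ℚ.∣ t ∣ ℚ.≤ ε)
          (solve 3 (λ p q r → (p :- q) :+ (q :- r) := p :- r) refl p q r)
          (ℚ.≤-trans (ℚ.∣p+q∣≤∣p∣+∣q∣ (p ℚ.- q) (q ℚ.- r)) (halves h₁ h₂))

      sumDiff : ∀ a b c d {ε} → ℚ.∣ a ℚ.- c ∣ ℚ.≤ ½ ℚ.* ε → ℚ.∣ b ℚ.- d ∣ ℚ.≤ ½ ℚ.* ε →
                ℚ.∣ (a ℚ.+ b) ℚ.- (c ℚ.+ d) ∣ ℚ.≤ ε
      sumDiff a b c d {ε} h₁ h₂ =
        ≡.subst (λ t → ℚ.∣ t ∣ ℚ.≤ ε)
          (solve 4 (λ a b c d → (a :- c) :+ (b :- d) := (a :+ b) :- (c :+ d)) refl a b c d)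
          (ℚ.≤-trans (ℚ.∣p+q∣≤∣p∣+∣q∣ (a ℚ.- c) (b ℚ.- d)) (halves h₁ h₂))

      prodDiff : ∀ a b c d {A B δ₁ δ₂ ε} → ℚ.∣ a ∣ ℚ.≤ A → ℚ.∣ d ∣ ℚ.≤ B →
                 A ℚ.* δ₂ ℚ.≤ ½ ℚ.* ε → B ℚ.* δ₁ ℚ.≤ ½ ℚ.* ε → 
                 0ℚ ℚ.≤ δ₁ → 0ℚ ℚ.≤ δ₂ →
                 ℚ.∣ a ℚ.- c ∣ ℚ.≤ δ₁ → ℚ.∣ b ℚ.- d ∣ ℚ.≤ δ₂ →
                 ℚ.∣ a ℚ.* b ℚ.- c ℚ.* d ∣ ℚ.≤ ε
      prodDiff a b c d {ε = ε} a≤A d≤B Aδ₂ Bδ₁ 0≤δ₁ 0≤δ₂ h₁ h₂ =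
        ≡.subst (λ t → ℚ.∣ t ∣ ℚ.≤ ε)
          (solve 4 (λ a b c d → a :* (b :- d) :+ d :* (a :- c) := a :* b :- c :* d) refl a b c d)
          (ℚ.≤-trans (ℚ.∣p+q∣≤∣p∣+∣q∣ (a ℚ.* (b ℚ.- d)) (d ℚ.* (a ℚ.- c)))
            (halves
              (≡.subst (ℚ._≤ _) (≡.sym (ℚ.∣p*q∣≡∣p∣*∣q∣ a (b ℚ.- d)))
                (ℚ.≤-trans (*-mono-≤ (ℚ.0≤∣p∣ a) 0≤δ₂ a≤A h₂) Aδ₂))
              (≡.subst (ℚ._≤ _) (≡.sym (ℚ.∣p*q∣≡∣p∣*∣q∣ d (a ℚ.- c)))
                (ℚ.≤-trans (*-mono-≤ (ℚ.0≤∣p∣ d) 0≤δ₁ d≤B h₁) Bδ₁))))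

  bounded : ∀ x → ∃[ B ] (0ℚ ℚ.≤ B × Eventually λ n → ℚ.∣ seq x n ∣ ℚ.≤ B)
  bounded x with cauchy x 1ℚ (ℚ.positive⁻¹ 1ℚ)
  ... | N , h = 1ℚ ℚ.+ ℚ.∣ seq x N ∣
              , +-nonneg (ℚ.nonNegative⁻¹ 1ℚ) (ℚ.0≤∣p∣ (seq x N))
              , N , λ n N≤n → ≡.subst (λ t → ℚ.∣ t ∣ ℚ.≤ 1ℚ ℚ.+ ℚ.∣ seq x N ∣)
                  (solve 2 (λ p q → (p :- q) :+ q := p) refl (seq x n) (seq x N))
                  (ℚ.≤-trans (ℚ.∣p+q∣≤∣p∣+∣q∣ (seq x n ℚ.- seq x N) (seq x N))
                    (ℚ.+-monoˡ-≤ ℚ.∣ seq x N ∣ (h n N N≤n ℕ.≤-refl)))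
    where open ℚ-Solver.+-*-Solver

  abstract
    fromℚ-cauchy : ∀ q → Cauchy (λ _ → q)
    fromℚ-cauchy q ε 0<ε = 0 , λ _ _ _ _ → ∣p-p∣≤ε q 0<ε

    +-cauchy : ∀ x y → Cauchy (λ n → seq x n ℚ.+ seq y n)
    +-cauchy x y ε 0<ε =
      let M , p = cauchy x (½ ℚ.* ε) (half-pos 0<ε)
          N , q = cauchy y (½ ℚ.* ε) (half-pos 0<ε)
      in M ℕ.⊔ N , λ m n ≤m ≤n →
         sumDiff (seq x m) (seq y m) (seq x n) (seq y n)
           (p m n (ℕ.m⊔n≤o⇒m≤o M N ≤m) (ℕ.m⊔n≤o⇒m≤o M N ≤n))
           (q m n (ℕ.m⊔n≤o⇒n≤o M N ≤m) (ℕ.m⊔n≤o⇒n≤o M N ≤n))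

    -‿cauchy : ∀ x → Cauchy (λ n → ℚ.- seq x n)
    -‿cauchy x ε 0<ε =
      let M , p = cauchy x ε 0<ε
      in M , λ m n ≤m ≤n → ≡.subst (ℚ._≤ ε) (neg (seq x n) (seq x m)) (p n m ≤n ≤m)
      where
      open ℚ-Solver.+-*-Solver
      neg : ∀ p q → ℚ.∣ p ℚ.- q ∣ ≡ ℚ.∣ ℚ.- q ℚ.- ℚ.- p ∣
      neg p q = cong ℚ.∣_∣ (solve 2 (λ p q → p :- q := :- q :- :- p) refl p q)

    *-cauchy : ∀ x y → Cauchy (λ n → seq x n ℚ.* seq y n)
    *-cauchy x y ε 0<ε =
      let A , 0≤A , K , a = bounded x
          B , 0≤B , L , b = bounded y
          δ₁ , 0<δ₁ , Bδ₁ = shrink B (½ ℚ.* ε) 0≤B (half-pos 0<ε)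
          δ₂ , 0<δ₂ , Aδ₂ = shrink A (½ ℚ.* ε) 0≤A (half-pos 0<ε)
          M , p = cauchy x δ₁ 0<δ₁
          N , q = cauchy y δ₂ 0<δ₂
      in (K ℕ.⊔ L) ℕ.⊔ (M ℕ.⊔ N) , λ m n ≤m ≤n →
         let KL≤m = ℕ.m⊔n≤o⇒m≤o (K ℕ.⊔ L) (M ℕ.⊔ N) ≤m
             KL≤n = ℕ.m⊔n≤o⇒m≤o (K ℕ.⊔ L) (M ℕ.⊔ N) ≤n
             MN≤m = ℕ.m⊔n≤o⇒n≤o (K ℕ.⊔ L) (M ℕ.⊔ N) ≤m
             MN≤n = ℕ.m⊔n≤o⇒n≤o (K ℕ.⊔ L) (M ℕ.⊔ N) ≤n
         in prodDiff (seq x m) (seq y m) (seq x n) (seq y n)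
              (a m (ℕ.m⊔n≤o⇒m≤o K L KL≤m)) (b n (ℕ.m⊔n≤o⇒n≤o K L KL≤n))
              Aδ₂ Bδ₁ (ℚ.<⇒≤ 0<δ₁) (ℚ.<⇒≤ 0<δ₂)
              (p m n (ℕ.m⊔n≤o⇒m≤o M N MN≤m) (ℕ.m⊔n≤o⇒m≤o M N MN≤n))
              (q m n (ℕ.m⊔n≤o⇒n≤o M N MN≤m) (ℕ.m⊔n≤o⇒n≤o M N MN≤n))

  fromℚ : ℚ → ℝ
  fromℚ q = mkℝ (λ _ → q) (fromℚ-cauchy q)

  0ℝ 1ℝ : ℝ
  0ℝ = fromℚ 0ℚ
  1ℝ = fromℚ 1ℚ

  _+_ _*_ : ℝ → ℝ → ℝ
  x + y = mkℝ (λ n → seq x n ℚ.+ seq y n) (+-cauchy x y)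
  x * y = mkℝ (λ n → seq x n ℚ.* seq y n) (*-cauchy x y)

  -_ : ℝ → ℝ
  - x = mkℝ (λ n → ℚ.- seq x n) (-‿cauchy x)

  pointwise : ∀ {x y} → (∀ n → seq x n ≡ seq y n) → x ≈ y
  pointwise {x} {y} eq = mk≈ λ ε 0<ε → ev-always λ n →
    ≡.subst (λ t → ℚ.∣ seq x n ℚ.- t ∣ ℚ.≤ ε) (eq n) (∣p-p∣≤ε (seq x n) 0<ε)

  ≈-refl : ∀ {x} → x ≈ x
  ≈-refl = pointwise λ _ → refl

  ≈-sym : ∀ {x y} → x ≈ y → y ≈ x
  ≈-sym {x} {y} h = mk≈ λ ε 0<ε →
    ev-map (λ n → ≡.subst (ℚ._≤ ε) (∣-∣-sym (seq x n) (seq y n))) (close h ε 0<ε)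

  ≈-trans : ∀ {x y z} → x ≈ y → y ≈ z → x ≈ z
  ≈-trans {x} {y} {z} h₁ h₂ = mk≈ λ ε 0<ε →
    ev-map₂ (λ n → triangle (seq x n) (seq y n) (seq z n))
      (close h₁ (½ ℚ.* ε) (half-pos 0<ε)) (close h₂ (½ ℚ.* ε) (half-pos 0<ε))

  +-cong : ∀ {x y u v} → x ≈ y → u ≈ v → x + u ≈ y + v
  +-cong {x} {y} {u} {v} h₁ h₂ = mk≈ λ ε 0<ε →
    ev-map₂ (λ n → sumDiff (seq x n) (seq u n) (seq y n) (seq v n))
      (close h₁ (½ ℚ.* ε) (half-pos 0<ε)) (close h₂ (½ ℚ.* ε) (half-pos 0<ε))

  -‿cong : ∀ {x y} → x ≈ y → - x ≈ - y
  -‿cong {x} {y} h = mk≈ λ ε 0<ε →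
    ev-map (λ n → ≡.subst (ℚ._≤ ε) (neg (seq x n) (seq y n))) (close h ε 0<ε)
    where
    open ℚ-Solver.+-*-Solver
    neg : ∀ p q → ℚ.∣ p ℚ.- q ∣ ≡ ℚ.∣ ℚ.- p ℚ.- ℚ.- q ∣
    neg p q = ≡.trans (∣-∣-sym p q)
      (cong ℚ.∣_∣ (solve 2 (λ p q → q :- p := :- p :- :- q) refl p q))

  *-cong : ∀ {x y u v} → x ≈ y → u ≈ v → x * u ≈ y * v
  *-cong {x} {y} {u} {v} h₁ h₂ = mk≈ λ ε 0<ε →
    let A , 0≤A , a = bounded x
        B , 0≤B , b = bounded v
        δ₁ , 0<δ₁ , Bδ₁ = shrink B (½ ℚ.* ε) 0≤B (half-pos 0<ε)
        δ₂ , 0<δ₂ , Aδ₂ = shrink A (½ ℚ.* ε) 0≤A (half-pos 0<ε)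
    in ev-map₂ (λ n (a , b) (p , q) →
         prodDiff (seq x n) (seq u n) (seq y n) (seq v n)
           a b Aδ₂ Bδ₁ (ℚ.<⇒≤ 0<δ₁) (ℚ.<⇒≤ 0<δ₂) p q)
       (ev-map₂ (λ _ → _,_) a b)
       (ev-map₂ (λ _ → _,_) (close h₁ δ₁ 0<δ₁) (close h₂ δ₂ 0<δ₂))

  pointwise-≤ : ∀ {x y} → (∀ n → seq x n ℚ.≤ seq y n) → x ≤ y
  pointwise-≤ {x} {y} h = mk≤ λ ε 0<ε → ev-always λ n → ℚ.≤-trans (h n)
    (≡.subst (ℚ._≤ seq y n ℚ.+ ε) (ℚ.+-identityʳ (seq y n))
      (ℚ.+-monoʳ-≤ (seq y n) (ℚ.<⇒≤ 0<ε)))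

  fromℚ-mono : ∀ {p q} → p ℚ.≤ q → fromℚ p ≤ fromℚ q
  fromℚ-mono {p} {q} p≤q = pointwise-≤ λ _ → p≤q

  ≈⇒≤ : ∀ {x y} → x ≈ y → x ≤ y
  ≈⇒≤ {x} {y} h = mk≤ λ ε 0<ε → ev-map (λ n d →
      ≡.subst (ℚ._≤ seq y n ℚ.+ ε)
        (solve 2 (λ p q → q :+ (p :- q) := p) refl (seq x n) (seq y n))
        (ℚ.+-monoʳ-≤ (seq y n) (ℚ.≤-trans (p≤∣p∣ _) d)))
    (close h ε 0<ε)
    where
    open ℚ-Solver.+-*-Solver
    p≤∣p∣ : ∀ p → p ℚ.≤ ℚ.∣ p ∣
    p≤∣p∣ p with ℚ.≤-total 0ℚ p
    ... | inj₁ 0≤p = ℚ.≤-reflexive (≡.sym (ℚ.0≤p⇒∣p∣≡p 0≤p))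

    ... | inj₂ p≤0 = ℚ.≤-trans p≤0 (ℚ.0≤∣p∣ p)

  ≤-trans : ∀ {x y z} → x ≤ y → y ≤ z → x ≤ z
  ≤-trans {x} {y} {z} h₁ h₂ = mk≤ λ ε 0<ε → ev-map₂ (λ n p q →
      ≡.subst (seq x n ℚ.≤_)
        (≡.trans (ℚ.+-assoc (seq z n) (½ ℚ.* ε) (½ ℚ.* ε)) (cong (seq z n ℚ.+_) (half+half ε)))
        (ℚ.≤-trans p (ℚ.+-monoˡ-≤ (½ ℚ.* ε) q)))
    (below h₁ (½ ℚ.* ε) (half-pos 0<ε)) (below h₂ (½ ℚ.* ε) (half-pos 0<ε))

  +-mono-≤ : ∀ {x y u v} → x ≤ y → u ≤ v → x + u ≤ y + v
  +-mono-≤ {x} {y} {u} {v} h₁ h₂ = mk≤ λ ε 0<ε → ev-map₂ (λ n p q →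
      ≡.subst (seq x n ℚ.+ seq u n ℚ.≤_)
        (≡.trans
          (solve 4 (λ a b c d → (a :+ c) :+ (b :+ d) := (a :+ b) :+ (c :+ d)) refl
            (seq y n) (seq v n) (½ ℚ.* ε) (½ ℚ.* ε))
          (cong (seq y n ℚ.+ seq v n ℚ.+_) (half+half ε)))
        (ℚ.+-mono-≤ p q))
    (below h₁ (½ ℚ.* ε) (half-pos 0<ε)) (below h₂ (½ ℚ.* ε) (half-pos 0<ε))
    where open ℚ-Solver.+-*-Solver

  NonNeg : ℝ → Set
  NonNeg x = ∀ n → 0ℚ ℚ.≤ seq x n

  *-monoˡ-≤ : ∀ c {x y} → NonNeg c → x ≤ y → c * x ≤ c * y
  *-monoˡ-≤ c {x} {y} 0≤c h = mk≤ λ ε 0<ε →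
    let B , 0≤B , b = bounded c
        δ , 0<δ , Bδ≤ε = shrink B ε 0≤B 0<ε
    in ev-map₂ (λ n c≤B x≤y+δ →
         ℚ.≤-trans (ℚ.*-monoˡ-≤-nonNeg (seq c n) {{ℚ.nonNegative (0≤c n)}} x≤y+δ)
           (≡.subst (ℚ._≤ seq c n ℚ.* seq y n ℚ.+ ε)
             (≡.sym (ℚ.*-distribˡ-+ (seq c n) (seq y n) δ))
             (ℚ.+-monoʳ-≤ (seq c n ℚ.* seq y n)
               (ℚ.≤-trans
                 (ℚ.*-monoʳ-≤-nonNeg δ {{ℚ.nonNegative (ℚ.<⇒≤ 0<δ)}}
                   (≡.subst (ℚ._≤ B) (ℚ.0≤p⇒∣p∣≡p (0≤c n)) c≤B))
                 Bδ≤ε))))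
       b (below h δ 0<δ)

record ℂ : Set where
  constructor _+i_
  field
    re im : ℝ
open ℂ public

module ℂ-Arithmetic where

  open Real using (0ℝ; 1ℝ)

  infix 4 _≈_
  infixl 6 _+_
  infixl 7 _*_
  infix  8 -_

  record _≈_ (z w : ℂ) : Set where
    constructor mk≈
    field
      re≈ : re z Real.≈ re w
      im≈ : im z Real.≈ im w

  0ℂ 1ℂ : ℂ
  0ℂ = 0ℝ +i 0ℝ
  1ℂ = 1ℝ +i 0ℝ

  _+_ _*_ : ℂ → ℂ → ℂ
  z + w = (re z Real.+ re w) +i (im z Real.+ im w)
  z * w = (re z Real.* re w Real.+ Real.- (im z Real.* im w))
       +i (re z Real.* im w Real.+ im z Real.* re w)

  -_ : ℂ → ℂ
  - z = (Real.- re z) +i (Real.- im z)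

  pointwise : ∀ {z w} → (∀ n → seq (re z) n ≡ seq (re w) n) →
              (∀ n → seq (im z) n ≡ seq (im w) n) → z ≈ w
  pointwise p q = mk≈ (Real.pointwise p) (Real.pointwise q)

  private
    module _ where
      open ℚ-Solver.+-*-Solver

      *-assoc : ∀ u v w → (u * v) * w ≈ u * (v * w)
      *-assoc u v w = pointwise
        (λ n → solve 6 (λ a b c d e f →
            (a :* c :+ :- (b :* d)) :* e :+ :- ((a :* d :+ b :* c) :* f) :=
            a :* (c :* e :+ :- (d :* f)) :+ :- (b :* (c :* f :+ d :* e))) refl
          (seq (re u) n) (seq (im u) n) (seq (re v) n) (seq (im v) n) (seq (re w) n) (seq (im w) n))
        (λ n → solve 6 (λ a b c d e f →
            (a :* c :+ :- (b :* d)) :* f :+ (a :* d :+ b :* c) :* e :=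
            a :* (c :* f :+ d :* e) :+ b :* (c :* e :+ :- (d :* f))) refl
          (seq (re u) n) (seq (im u) n) (seq (re v) n) (seq (im v) n) (seq (re w) n) (seq (im w) n))

      *-comm : ∀ u v → u * v ≈ v * u
      *-comm u v = pointwise
        (λ n → solve 4 (λ a b c d → a :* c :+ :- (b :* d) := c :* a :+ :- (d :* b)) refl
          (seq (re u) n) (seq (im u) n) (seq (re v) n) (seq (im v) n))
        (λ n → solve 4 (λ a b c d → a :* d :+ b :* c := c :* b :+ d :* a) refl
          (seq (re u) n) (seq (im u) n) (seq (re v) n) (seq (im v) n))

      *-identityˡ : ∀ u → 1ℂ * u ≈ u
      *-identityˡ u = pointwise
        (λ n → solve 2 (λ a b → con 1ℚ :* a :+ :- (con 0ℚ :* b) := a) refl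
          (seq (re u) n) (seq (im u) n))
        (λ n → solve 2 (λ a b → con 1ℚ :* b :+ con 0ℚ :* a := b) refl
          (seq (re u) n) (seq (im u) n))

      *-identityʳ : ∀ u → u * 1ℂ ≈ u
      *-identityʳ u = pointwise
        (λ n → solve 2 (λ a b → a :* con 1ℚ :+ :- (b :* con 0ℚ) := a) refl
          (seq (re u) n) (seq (im u) n))
        (λ n → solve 2 (λ a b → a :* con 0ℚ :+ b :* con 1ℚ := b) refl
          (seq (re u) n) (seq (im u) n))

      distribˡ : ∀ u v w → u * (v + w) ≈ u * v + u * w
      distribˡ u v w = pointwise
        (λ n → solve 6 (λ a b c d e f →
            a :* (c :+ e) :+ :- (b :* (d :+ f)) :=
            (a :* c :+ :- (b :* d)) :+ (a :* e :+ :- (b :* f))) refl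
          (seq (re u) n) (seq (im u) n) (seq (re v) n) (seq (im v) n) (seq (re w) n) (seq (im w) n))
        (λ n → solve 6 (λ a b c d e f →
            a :* (d :+ f) :+ b :* (c :+ e) :=
            (a :* d :+ b :* c) :+ (a :* f :+ b :* e)) refl
          (seq (re u) n) (seq (im u) n) (seq (re v) n) (seq (im v) n) (seq (re w) n) (seq (im w) n))

      distribʳ : ∀ w u v → (u + v) * w ≈ u * w + v * w
      distribʳ w u v = pointwise
        (λ n → solve 6 (λ a b c d e f →
            (a :+ c) :* e :+ :- ((b :+ d) :* f) :=
            (a :* e :+ :- (b :* f)) :+ (c :* e :+ :- (d :* f))) refl
          (seq (re u) n) (seq (im u) n) (seq (re v) n) (seq (im v) n) (seq (re w) n) (seq (im w) n))
        (λ n → solve 6 (λ a b c d e f →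
            (a :+ c) :* f :+ (b :+ d) :* e :=
            (a :* f :+ b :* e) :+ (c :* f :+ d :* e)) refl
          (seq (re u) n) (seq (im u) n) (seq (re v) n) (seq (im v) n) (seq (re w) n) (seq (im w) n))

    ≈-refl : ∀ {z} → z ≈ z
    ≈-refl = mk≈ Real.≈-refl Real.≈-refl

    ≈-sym : ∀ {z w} → z ≈ w → w ≈ z
    ≈-sym (mk≈ p q) = mk≈ (Real.≈-sym p) (Real.≈-sym q)

    ≈-trans : ∀ {u v w} → u ≈ v → v ≈ w → u ≈ w
    ≈-trans (mk≈ p q) (mk≈ p′ q′) = mk≈ (Real.≈-trans p p′) (Real.≈-trans q q′)

    +-cong : ∀ {u v w t} → u ≈ v → w ≈ t → u + w ≈ v + t
    +-cong (mk≈ p q) (mk≈ p′ q′) = mk≈ (Real.+-cong p p′) (Real.+-cong q q′)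

    -‿cong : ∀ {u v} → u ≈ v → - u ≈ - v
    -‿cong (mk≈ p q) = mk≈ (Real.-‿cong p) (Real.-‿cong q)

    *-cong : ∀ {u v w t} → u ≈ v → w ≈ t → u * w ≈ v * t
    *-cong (mk≈ p q) (mk≈ p′ q′) = mk≈
      (Real.+-cong (Real.*-cong p p′) (Real.-‿cong (Real.*-cong q q′)))
      (Real.+-cong (Real.*-cong p q′) (Real.*-cong q p′))

  ℂ-commutativeRing : CommutativeRing 0ℓ 0ℓ
  ℂ-commutativeRing = record
    { Carrier = ℂ ; _≈_ = _≈_ ; _+_ = _+_ ; _*_ = _*_ ; -_ = -_ ; 0# = 0ℂ ; 1# = 1ℂ
    ; isCommutativeRing = record
      { isRing = record
        { +-isAbelianGroup = record
          { isGroup = record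
            { isMonoid = record
              { isSemigroup = record
                { isMagma = record
                  { isEquivalence = record
                    { refl  = ≈-refl
                    ; sym   = ≈-sym
                    ; trans = ≈-trans
                    }
                  ; ∙-cong = +-cong
                  }
                ; assoc = λ u v w → pointwise
                    (λ n → ℚ.+-assoc (seq (re u) n) (seq (re v) n) (seq (re w) n))
                    (λ n → ℚ.+-assoc (seq (im u) n) (seq (im v) n) (seq (im w) n))
                }
              ; identity =
                  (λ u → pointwise
                    (λ n → ℚ.+-identityˡ (seq (re u) n)) (λ n → ℚ.+-identityˡ (seq (im u) n))) ,
                  (λ u → pointwise
                    (λ n → ℚ.+-identityʳ (seq (re u) n)) (λ n → ℚ.+-identityʳ (seq (im u) n)))
              }
            ; inverse =
                (λ u → pointwise
                  (λ n → ℚ.+-inverseˡ (seq (re u) n)) (λ n → ℚ.+-inverseˡ (seq (im u) n))) ,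
                (λ u → pointwise
                  (λ n → ℚ.+-inverseʳ (seq (re u) n)) (λ n → ℚ.+-inverseʳ (seq (im u) n)))
            ; ⁻¹-cong = -‿cong
            }
          ; comm = λ u v → pointwise
              (λ n → ℚ.+-comm (seq (re u) n) (seq (re v) n))
              (λ n → ℚ.+-comm (seq (im u) n) (seq (im v) n))
          }
        ; *-cong = *-cong
        ; *-assoc = *-assoc
        ; *-identity = *-identityˡ , *-identityʳ
        ; distrib = distribˡ , distribʳ
        }
      ; *-comm = *-comm
      }
    }

open ℂ-Arithmetic using (ℂ-commutativeRing) public
open CommutativeRing ℂ-commutativeRing public
  using (_≈_; _+_; _*_; -_; _-_; 0#; 1#)
open RawSemiringDefs (Semiring.rawSemiring (CommutativeRing.semiring ℂ-commutativeRing)) public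
  using (_^_) renaming (_×_ to _·_)

fromℕ : ℕ → ℂ
fromℕ n = n · 1#

normSq : ℂ → ℝ
normSq z = re z Real.* re z Real.+ im z Real.* im z

-- ∣ z ∣ ≤ c ∣ w ∣ for a rational c ≥ 0, squared to avoid square roots.
Dominated : ℂ → ℚ → ℂ → Set
Dominated z c w = normSq z Real.≤ Real.fromℚ (c ℚ.* c) Real.* normSq w

-- ∣ z ∣ ≤ c, likewise.
Bounded : ℂ → ℚ → Set
Bounded z c = normSq z Real.≤ Real.fromℚ (c ℚ.* c)

-- ∣ z ∣ ≥ c, likewise.
BoundedBelow : ℂ → ℚ → Set
BoundedBelow z c = Real.fromℚ (c ℚ.* c) Real.≤ normSq z

infix 4 _#_

-- z ≠ w in the constructively positive sense.
_#_ : ℂ → ℂ → Set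
z # w = ∃[ c ] (0ℚ ℚ.< c × BoundedBelow (z - w) c)

Domain : Set₁
Domain = ℂ → Set

Fun : Domain → Set
Fun D = ∀ z → D z → ℂ

IsOpen : Domain → Set
IsOpen D = ∀ z → D z → ∃[ r ] (0ℚ ℚ.< r × (∀ w → Bounded (w - z) r → D w))

LittleO : ∀ {D} → ℂ → Fun D → Set
LittleO {D} z e = ∀ ε → 0ℚ ℚ.< ε → ∃[ δ ] (0ℚ ℚ.< δ ×
  (∀ w (w∈D : D w) → Bounded (w - z) δ → Dominated (e w w∈D) ε (w - z)))

HasDerivativeAt : ∀ {D} → Fun D → (z : ℂ) → D z → ℂ → Set
HasDerivativeAt {D} f z z∈D c = LittleO {D} z λ w w∈D → (f w w∈D - f z z∈D) - c * (w - z)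

-- A holomorphic function together with its derivatives of all orders:
-- derivative n is the n-th derivative of derivative 0.  Classically the higher
-- derivatives exist and are determined by the function; constructively they are data.
record Holomorphic (D : Domain) : Set where
  field
    derivative   : ℕ → Fun D
    isDerivative : ∀ n z (z∈D : D z) →
      HasDerivativeAt {D} (derivative n) z z∈D (derivative (suc n) z z∈D)
open Holomorphic public

module ProductRule where

  normSq-nonneg : ∀ z → Real.NonNeg (normSq z)
  normSq-nonneg z n =
    +-nonneg (square-nonneg (seq (re z) n)) (square-nonneg (seq (im z) n))

  normSq-cong : ∀ {z w} → z ≈ w → normSq z Real.≈ normSq w
  normSq-cong (ℂ-Arithmetic.mk≈ p q) = Real.+-cong (Real.*-cong p p) (Real.*-cong q q)

  infixr 2 _▸_
  _▸_ : ∀ {x y z} → x Real.≤ y → y Real.≤ z → x Real.≤ z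
  _▸_ = Real.≤-trans

  pt≤ : ∀ x y → (∀ n → seq x n ≡ seq y n) → x Real.≤ y
  pt≤ x y h = Real.pointwise-≤ λ n → ℚ.≤-reflexive (h n)

  scale : ∀ q {x y} → 0ℚ ℚ.≤ q → x Real.≤ y → Real.fromℚ q Real.* x Real.≤ Real.fromℚ q Real.* y
  scale q 0≤q = Real.*-monoˡ-≤ (Real.fromℚ q) (λ _ → 0≤q)

  Dominated-cong : ∀ {z z′} c w → z ≈ z′ → Dominated z c w → Dominated z′ c w
  Dominated-cong c w eq h =
    _▸_ (Real.≈⇒≤ (Real.≈-sym (normSq-cong eq))) h

  weaken : ∀ z {c d} w → 0ℚ ℚ.≤ c → c ℚ.≤ d → Dominated z c w → Dominated z d w
  weaken z {c} {d} w 0≤c c≤d h =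
    _▸_ h
      (Real.pointwise-≤ λ n →
        ℚ.*-monoʳ-≤-nonNeg (seq (normSq w) n) {{ℚ.nonNegative (normSq-nonneg w n)}}
          (square-mono 0≤c c≤d))

  Bounded-weaken : ∀ z {c d} → 0ℚ ℚ.≤ c → c ℚ.≤ d → Bounded z c → Bounded z d
  Bounded-weaken z {c} {d} 0≤c c≤d h =
    _▸_ h
      (Real.fromℚ-mono (square-mono 0≤c c≤d))

  -- ∣a + b∣² ≤ 2 ∣a∣² + 2 ∣b∣²
  dominated-+ : ∀ a b c w → Dominated a (½ ℚ.* c) w → Dominated b (½ ℚ.* c) w → Dominated (a + b) c w
  dominated-+ a b c w ha hb =
    _▸_ (Real.pointwise-≤ λ n →
        parallelogram (seq (re a) n) (seq (im a) n) (seq (re b) n) (seq (im b) n))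
      (_▸_ (scale 2ℚ (ℚ.nonNegative⁻¹ 2ℚ)
          (Real.+-mono-≤ ha hb))
        (pt≤ (two Real.* (K Real.+ K)) (Real.fromℚ (c ℚ.* c) Real.* H) λ n →
          solve 2 (λ c h → con 2ℚ :* ((con ½ :* c) :* (con ½ :* c) :* h :+ (con ½ :* c) :* (con ½ :* c) :* h)
                         := c :* c :* h) refl c (seq H n)))
    where
    open ℚ-Solver.+-*-Solver
    2ℚ = 1ℚ ℚ.+ 1ℚ
    two = Real.fromℚ 2ℚ
    H = normSq w
    K = Real.fromℚ ((½ ℚ.* c) ℚ.* (½ ℚ.* c)) Real.* H
    parallelogram : ∀ x y u v →
      (x ℚ.+ u) ℚ.* (x ℚ.+ u) ℚ.+ (y ℚ.+ v) ℚ.* (y ℚ.+ v) ℚ.≤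
      2ℚ ℚ.* ((x ℚ.* x ℚ.+ y ℚ.* y) ℚ.+ (u ℚ.* u ℚ.+ v ℚ.* v))
    parallelogram x y u v = ≡.subst₂ ℚ._≤_ (ℚ.+-identityʳ S)
      (solve 4 (λ x y u v →
          ((x :+ u) :* (x :+ u) :+ (y :+ v) :* (y :+ v)) :+
          ((x :- u) :* (x :- u) :+ (y :- v) :* (y :- v)) :=
          con 2ℚ :* ((x :* x :+ y :* y) :+ (u :* u :+ v :* v))) refl x y u v)
      (ℚ.+-monoʳ-≤ S (+-nonneg (square-nonneg (x ℚ.- u)) (square-nonneg (y ℚ.- v))))
      where S = (x ℚ.+ u) ℚ.* (x ℚ.+ u) ℚ.+ (y ℚ.+ v) ℚ.* (y ℚ.+ v)

  normSq-* : ∀ a b n → seq (normSq (a * b)) n ≡ seq (normSq a Real.* normSq b) n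
  normSq-* a b n = solve 4 (λ x y u v →
      (x :* u :+ :- (y :* v)) :* (x :* u :+ :- (y :* v)) :+ (x :* v :+ y :* u) :* (x :* v :+ y :* u) :=
      (x :* x :+ y :* y) :* (u :* u :+ v :* v)) refl
    (seq (re a) n) (seq (im a) n) (seq (re b) n) (seq (im b) n)
    where open ℚ-Solver.+-*-Solver

  -- ∣a∣ ≤ A and ∣b∣ ≤ B∣h∣ give ∣ab∣ ≤ AB∣h∣
  dominated-* : ∀ a b {A B} h → 0ℚ ℚ.≤ A → Bounded a A → Dominated b B h → Dominated (a * b) (A ℚ.* B) h
  dominated-* a b {A} {B} h 0≤A ha hb =
    _▸_ (pt≤ (normSq (a * b)) (normSq a Real.* normSq b) (normSq-* a b))
    (_▸_ (pt≤ (normSq a Real.* normSq b) (normSq b Real.* normSq a) λ n → ℚ.*-comm (seq (normSq a) n) (seq (normSq b) n))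
    (_▸_ (Real.*-monoˡ-≤ (normSq b) (normSq-nonneg b) ha)
    (_▸_ (pt≤ (normSq b Real.* A²) (A² Real.* normSq b) λ n → ℚ.*-comm (seq (normSq b) n) (A ℚ.* A))
    (_▸_ (scale (A ℚ.* A) (*-nonneg 0≤A 0≤A) hb)
      (pt≤ (A² Real.* (B² Real.* normSq h)) AB λ n →
        solve 3 (λ a b h → a :* a :* (b :* b :* h) := a :* b :* (a :* b) :* h) refl A B (seq (normSq h) n))))))
    where
    open ℚ-Solver.+-*-Solver
    A² = Real.fromℚ (A ℚ.* A)
    B² = Real.fromℚ (B ℚ.* B)
    AB = Real.fromℚ (A ℚ.* B ℚ.* (A ℚ.* B)) Real.* normSq h

  -- ∣a∣ ≤ A∣h∣ and ∣h∣ ≤ δ give ∣a∣ ≤ Aδ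
  dominated⇒bounded : ∀ a {A δ} h → Dominated a A h → Bounded h δ → Bounded a (A ℚ.* δ)
  dominated⇒bounded a {A} {δ} h ha hδ =
    _▸_ ha
    (_▸_ (scale (A ℚ.* A) (square-nonneg A) hδ)
      (pt≤ (A² Real.* Real.fromℚ (δ ℚ.* δ)) (Real.fromℚ (A ℚ.* δ ℚ.* (A ℚ.* δ))) λ n →
        solve 2 (λ a d → a :* a :* (d :* d) := a :* d :* (a :* d)) refl A δ))
    where
    open ℚ-Solver.+-*-Solver
    A² = Real.fromℚ (A ℚ.* A)

  bound : ∀ a → ∃[ A ] (0ℚ ℚ.≤ A × Bounded a A)
  bound a =
    let B , 0≤B , N , h = Real.bounded (normSq a)
        1+B = 1ℚ ℚ.+ B
        0≤1+B = +-nonneg (ℚ.nonNegative⁻¹ 1ℚ) 0≤B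
    in 1+B , 0≤1+B , Real.mk≤ λ ε 0<ε → N , λ n N≤n →
       ℚ.≤-trans (≡.subst (ℚ._≤ B) (ℚ.0≤p⇒∣p∣≡p (normSq-nonneg a n)) (h n N≤n))
       (≡.subst (B ℚ.≤_) (≡.sym (solve 2 (λ b e → (con 1ℚ :+ b) :* (con 1ℚ :+ b) :+ e
            := b :+ (con 1ℚ :+ b :+ b :* b :+ e)) refl B ε))
          (≡.subst (ℚ._≤ B ℚ.+ (1+B ℚ.+ B ℚ.* B ℚ.+ ε)) (ℚ.+-identityʳ B)
            (ℚ.+-monoʳ-≤ B (+-nonneg (+-nonneg 0≤1+B (*-nonneg 0≤B 0≤B)) (ℚ.<⇒≤ 0<ε)))))
    where open ℚ-Solver.+-*-Solver

  module _ {D : Domain} (z : ℂ) where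

    BigO : Fun D → Set
    BigO e = ∃[ B ] (0ℚ ℚ.≤ B × ∃[ δ ] (0ℚ ℚ.< δ ×
      (∀ w (w∈D : D w) → Bounded (w - z) δ → Dominated (e w w∈D) B (w - z))))

    ⊓-pos : ∀ {p q} → 0ℚ ℚ.< p → 0ℚ ℚ.< q → 0ℚ ℚ.< p ℚ.⊓ q
    ⊓-pos {p} {q} 0<p 0<q with ℚ.⊓-sel p q
    ... | inj₁ eq = ≡.subst (0ℚ ℚ.<_) (≡.sym eq) 0<p
    ... | inj₂ eq = ≡.subst (0ℚ ℚ.<_) (≡.sym eq) 0<q

    fst : ∀ {p q} → 0ℚ ℚ.< p → 0ℚ ℚ.< q → ∀ w → Bounded (w - z) (p ℚ.⊓ q) → Bounded (w - z) p
    fst {p} {q} 0<p 0<q w = Bounded-weaken (w - z) {p ℚ.⊓ q} {p} (ℚ.<⇒≤ (⊓-pos 0<p 0<q)) (ℚ.p⊓q≤p p q)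

    snd : ∀ {p q} → 0ℚ ℚ.< p → 0ℚ ℚ.< q → ∀ w → Bounded (w - z) (p ℚ.⊓ q) → Bounded (w - z) q
    snd {p} {q} 0<p 0<q w = Bounded-weaken (w - z) {p ℚ.⊓ q} {q} (ℚ.<⇒≤ (⊓-pos 0<p 0<q)) (ℚ.p⊓q≤q p q)

    o-cong : ∀ {e e′ : Fun D} → (∀ w w∈D → e w w∈D ≈ e′ w w∈D) → LittleO {D} z e → LittleO {D} z e′
    o-cong {e} {e′} eq h ε 0<ε =
      let δ , 0<δ , b = h ε 0<ε
      in δ , 0<δ , λ w d w≤δ → Dominated-cong ε (w - z) (eq w d) (b w d w≤δ)

    o-+ : ∀ {e e′ : Fun D} → LittleO {D} z e → LittleO {D} z e′ →
          LittleO {D} z (λ w d → e w d + e′ w d)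
    o-+ {e} {e′} h h′ ε 0<ε =
      let δ , 0<δ , b = h (½ ℚ.* ε) (half-pos 0<ε)
          δ′ , 0<δ′ , b′ = h′ (½ ℚ.* ε) (half-pos 0<ε)
      in δ ℚ.⊓ δ′ , ⊓-pos 0<δ 0<δ′ , λ w d w≤ →
         dominated-+ (e w d) (e′ w d) ε (w - z)
           (b w d (fst 0<δ 0<δ′ w w≤)) (b′ w d (snd 0<δ 0<δ′ w w≤))

    o-* : ∀ {e : Fun D} c → LittleO {D} z e → LittleO {D} z (λ w d → c * e w d)
    o-* {e} c h ε 0<ε =
      let A , 0≤A , cA = bound c
          ε′ , 0<ε′ , Aε′≤ε = shrink A ε 0≤A 0<ε
          δ , 0<δ , b = h ε′ 0<ε′
      in δ , 0<δ , λ w d w≤δ →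
         weaken (c * e w d) (w - z) (*-nonneg 0≤A (ℚ.<⇒≤ 0<ε′)) Aε′≤ε
           (dominated-* c (e w d) (w - z) 0≤A cA (b w d w≤δ))

    O-difference : ∀ (f : Fun D) (z∈D : D z) c → HasDerivativeAt {D} f z z∈D c →
                   BigO (λ w d → f w d - f z z∈D)
    O-difference f z∈D c h =
      let A , 0≤A , cA = bound c
          δ , 0<δ , b = h 1ℚ (ℚ.positive⁻¹ 1ℚ)
          2ℚ = 1ℚ ℚ.+ 1ℚ
          B = 2ℚ ℚ.* (A ℚ.+ 1ℚ)
          ½B≡ = ≡.trans (≡.sym (ℚ.*-assoc ½ 2ℚ (A ℚ.+ 1ℚ))) (ℚ.*-identityˡ (A ℚ.+ 1ℚ))
          A≤ = ≡.subst₂ ℚ._≤_ (≡.sym (ℚ.*-identityʳ A)) (≡.sym ½B≡)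
                 (≡.subst (ℚ._≤ A ℚ.+ 1ℚ) (ℚ.+-identityʳ A) (ℚ.+-monoʳ-≤ A (ℚ.nonNegative⁻¹ 1ℚ)))
          1≤ = ≡.subst (1ℚ ℚ.≤_) (≡.sym ½B≡)
                 (≡.subst (ℚ._≤ A ℚ.+ 1ℚ) (ℚ.+-identityˡ 1ℚ) (ℚ.+-monoˡ-≤ 1ℚ 0≤A))
      in B , *-nonneg (ℚ.nonNegative⁻¹ 2ℚ) (+-nonneg 0≤A (ℚ.nonNegative⁻¹ 1ℚ)) , δ , 0<δ , λ w d w≤δ →
         Dominated-cong B (w - z)
           (cancel (c * (w - z)) (f w d - f z z∈D))
           (dominated-+ (c * (w - z)) ((f w d - f z z∈D) - c * (w - z)) B (w - z)
             (weaken (c * (w - z)) (w - z) (*-nonneg 0≤A (ℚ.nonNegative⁻¹ 1ℚ)) A≤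
               (dominated-* c (w - z) (w - z) 0≤A cA (self (w - z))))
             (weaken ((f w d - f z z∈D) - c * (w - z)) (w - z) (ℚ.nonNegative⁻¹ 1ℚ) 1≤ (b w d w≤δ)))
      where
      open ℚ-Solver.+-*-Solver
      self : ∀ h → Dominated h 1ℚ h
      self h = pt≤ (normSq h) (Real.fromℚ (1ℚ ℚ.* 1ℚ) Real.* normSq h)
        λ n → ≡.sym (ℚ.*-identityˡ (seq (normSq h) n))
      cancel : ∀ a b → a + (b - a) ≈ b
      cancel a b = ℂ-Arithmetic.pointwise
        (λ n → solve 2 (λ a b → a :+ (b :- a) := b) refl (seq (re a) n) (seq (re b) n))
        (λ n → solve 2 (λ a b → a :+ (b :- a) := b) refl (seq (im a) n) (seq (im b) n))

    O*O : ∀ {e e′ : Fun D} → BigO e → BigO e′ → LittleO {D} z (λ w d → e w d * e′ w d)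
    O*O {e} {e′} (A , 0≤A , δ , 0<δ , a) (B , 0≤B , δ′ , 0<δ′ , b) ε 0<ε =
      let η , 0<η , ABη≤ε = shrink (A ℚ.* B) ε (*-nonneg 0≤A 0≤B) 0<ε
          0<δδ′ = ⊓-pos 0<δ 0<δ′
      in η ℚ.⊓ (δ ℚ.⊓ δ′) , ⊓-pos 0<η 0<δδ′ , λ w d w≤ →
         let w≤η = fst 0<η 0<δδ′ w w≤
             w≤δδ′ = snd 0<η 0<δδ′ w w≤
         in weaken (e w d * e′ w d) (w - z)
              (*-nonneg (*-nonneg 0≤A (ℚ.<⇒≤ 0<η)) 0≤B)
              (≡.subst (ℚ._≤ ε)
                (solve 3 (λ a b h → a :* b :* h := a :* h :* b) refl A B η) ABη≤ε)
              (dominated-* (e w d) (e′ w d) (w - z) (*-nonneg 0≤A (ℚ.<⇒≤ 0<η))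
                (dominated⇒bounded (e w d) {A} {η} (w - z) (a w d (fst 0<δ 0<δ′ w w≤δδ′)) w≤η)
                (b w d (snd 0<δ 0<δ′ w w≤δδ′)))
      where open ℚ-Solver.+-*-Solver

    sum-rule : ∀ (f g : Fun D) (z∈D : D z) c c′ →
      HasDerivativeAt {D} f z z∈D c → HasDerivativeAt {D} g z z∈D c′ →
      HasDerivativeAt {D} (λ w d → f w d + g w d) z z∈D (c + c′)
    sum-rule f g z∈D c c′ hf hg =
      o-cong (λ w d → identity (f w d) (f z z∈D) c (w - z) (g w d) (g z z∈D) c′) (o-+ hf hg)
      where
      open ℚ-Solver.+-*-Solver
      identity : ∀ f f₀ c h g g₀ c′ →
        ((f - f₀) - c * h) + ((g - g₀) - c′ * h) ≈ ((f + g) - (f₀ + g₀)) - (c + c′) * h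
      identity f f₀ c h g g₀ c′ = ℂ-Arithmetic.pointwise
        (λ n → solve 10 (λ f f₀ g g₀ c d c′ d′ h i →
            ((f :- f₀) :- (c :* h :+ :- (d :* i))) :+ ((g :- g₀) :- (c′ :* h :+ :- (d′ :* i))) :=
            ((f :+ g) :- (f₀ :+ g₀)) :- ((c :+ c′) :* h :+ :- ((d :+ d′) :* i))) refl
          (seq (re f) n) (seq (re f₀) n) (seq (re g) n) (seq (re g₀) n)
          (seq (re c) n) (seq (im c) n) (seq (re c′) n) (seq (im c′) n) (seq (re h) n) (seq (im h) n))
        (λ n → solve 10 (λ f f₀ g g₀ c d c′ d′ h i →
            ((f :- f₀) :- (c :* i :+ d :* h)) :+ ((g :- g₀) :- (c′ :* i :+ d′ :* h)) :=
            ((f :+ g) :- (f₀ :+ g₀)) :- ((c :+ c′) :* i :+ (d :+ d′) :* h)) refl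
          (seq (im f) n) (seq (im f₀) n) (seq (im g) n) (seq (im g₀) n)
          (seq (re c) n) (seq (im c) n) (seq (re c′) n) (seq (im c′) n) (seq (re h) n) (seq (im h) n))

    product-rule : ∀ (f g : Fun D) (z∈D : D z) c c′ →
      HasDerivativeAt {D} f z z∈D c → HasDerivativeAt {D} g z z∈D c′ →
      HasDerivativeAt {D} (λ w d → f w d * g w d) z z∈D (c * g z z∈D + f z z∈D * c′)
    product-rule f g z∈D c c′ hf hg =
      o-cong (λ w d → identity (f w d) (f z z∈D) c (w - z) (g w d) (g z z∈D) c′)
        (o-+ (O*O (O-difference f z∈D c hf) (O-difference g z∈D c′ hg))
             (o-+ (o-* (f z z∈D) hg) (o-* (g z z∈D) hf)))
      where
      open ℚ-Solver.+-*-Solver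
      identity : ∀ f f₀ c h g g₀ c′ →
        (f - f₀) * (g - g₀) + (f₀ * ((g - g₀) - c′ * h) + g₀ * ((f - f₀) - c * h)) ≈
        (f * g - f₀ * g₀) - (c * g₀ + f₀ * c′) * h
      identity f f₀ c h g g₀ c′ = ℂ-Arithmetic.pointwise
        (λ n → solve 14 (λ f F f₀ F₀ c C h H g G g₀ G₀ c′ C′ →
            (((f :- f₀) :* (g :- g₀) :+ :- ((F :- F₀) :* (G :- G₀))) :+ ((f₀ :* ((g :- g₀) :- (c′ :* h :+ :- (C′ :* H))) :+ :- (F₀ :* ((G :- G₀) :- (c′ :* H :+ C′ :* h)))) :+ (g₀ :* ((f :- f₀) :- (c :* h :+ :- (C :* H))) :+ :- (G₀ :* ((F :- F₀) :- (c :* H :+ C :* h)))))) :=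
            (((f :* g :+ :- (F :* G)) :- (f₀ :* g₀ :+ :- (F₀ :* G₀))) :- (((c :* g₀ :+ :- (C :* G₀)) :+ (f₀ :* c′ :+ :- (F₀ :* C′))) :* h :+ :- (((c :* G₀ :+ C :* g₀) :+ (f₀ :* C′ :+ F₀ :* c′)) :* H)))) refl
          (seq (re f) n) (seq (im f) n) (seq (re f₀) n) (seq (im f₀) n) (seq (re c) n) (seq (im c) n)
          (seq (re h) n) (seq (im h) n) (seq (re g) n) (seq (im g) n) (seq (re g₀) n) (seq (im g₀) n) (seq (re c′) n) (seq (im c′) n))
        (λ n → solve 14 (λ f F f₀ F₀ c C h H g G g₀ G₀ c′ C′ →
            (((f :- f₀) :* (G :- G₀) :+ (F :- F₀) :* (g :- g₀)) :+ ((f₀ :* ((G :- G₀) :- (c′ :* H :+ C′ :* h)) :+ F₀ :* ((g :- g₀) :- (c′ :* h :+ :- (C′ :* H)))) :+ (g₀ :* ((F :- F₀) :- (c :* H :+ C :* h)) :+ G₀ :* ((f :- f₀) :- (c :* h :+ :- (C :* H)))))) :=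
            (((f :* G :+ F :* g) :- (f₀ :* G₀ :+ F₀ :* g₀)) :- (((c :* g₀ :+ :- (C :* G₀)) :+ (f₀ :* c′ :+ :- (F₀ :* C′))) :* H :+ ((c :* G₀ :+ C :* g₀) :+ (f₀ :* C′ :+ F₀ :* c′)) :* h))) refl
          (seq (re f) n) (seq (im f) n) (seq (re f₀) n) (seq (im f₀) n) (seq (re c) n) (seq (im c) n)
          (seq (re h) n) (seq (im h) n) (seq (re g) n) (seq (im g) n) (seq (re g₀) n) (seq (im g₀) n) (seq (re c′) n) (seq (im c′) n))

module _ {D : Domain} where

  differentiate : Holomorphic D → Holomorphic D
  differentiate f = record
    { derivative   = λ n → derivative f (suc n)
    ; isDerivative = λ n → isDerivative f (suc n)
    }

  -- The n-th derivative of a product, by iterating the Leibniz rule (fg)′ = f′g + fg′.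
  productDerivative : Holomorphic D → Holomorphic D → ℕ → Fun D
  productDerivative f g zero    z z∈D = derivative f 0 z z∈D * derivative g 0 z z∈D
  productDerivative f g (suc n) z z∈D =
    productDerivative (differentiate f) g n z z∈D + productDerivative f (differentiate g) n z z∈D

  infixl 7 _⊛_

  _⊛_ : Holomorphic D → Holomorphic D → Holomorphic D
  f ⊛ g = record { derivative = productDerivative f g ; isDerivative = leibniz f g }
    where
    leibniz : ∀ f g n z (z∈D : D z) → HasDerivativeAt {D} (productDerivative f g n) z z∈D
                                        (productDerivative f g (suc n) z z∈D)
    leibniz f g zero z z∈D = ProductRule.product-rule z
      (derivative f 0) (derivative g 0) z∈D (derivative f 1 z z∈D) (derivative g 1 z z∈D)
      (isDerivative f 0 z z∈D) (isDerivative g 0 z z∈D)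
    leibniz f g (suc n) z z∈D = ProductRule.sum-rule z
      (productDerivative (differentiate f) g n) (productDerivative f (differentiate g) n) z∈D
      (productDerivative (differentiate f) g (suc n) z z∈D)
      (productDerivative f (differentiate g) (suc n) z z∈D)
      (leibniz (differentiate f) g n z z∈D) (leibniz f (differentiate g) n z z∈D)

restrict : ∀ {D E : Domain} → (∀ z → E z → D z) → Holomorphic D → Holomorphic E
restrict E⊆D f = record
  { derivative   = λ n z z∈E → derivative f n z (E⊆D z z∈E)
  ; isDerivative = λ n z z∈E ε 0<ε →
      let δ , 0<δ , b = isDerivative f n z (E⊆D z z∈E) ε 0<ε
      in δ , 0<δ , λ w w∈E → b w (E⊆D w w∈E)
  }

Entire : Set
Entire = Holomorphic (λ _ → ⊤)

product : List ℂ → ℂ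
product = foldr _*_ 1#

-- In every disc ∣ w ∣ ≤ R all singularities lie in a finite list ps of points
-- (listed with multiplicity), and multiplying by ∏ (w − p) makes the function
-- bounded there.  So singularities are locally finite and at worst poles.
record Meromorphic : Set₁ where
  field
    domain   : Domain
    isOpen   : IsOpen domain
    function : Holomorphic domain
    poles    : ∀ R → ∃[ ps ] ∃[ M ] (∀ w → Bounded w R → All (w #_) ps →
                 Σ[ w∈D ∈ domain w ]
                   Bounded (product (map (λ p → w - p) ps) * derivative function 0 w w∈D) M)
open Meromorphic public

module _ {D : Domain} where

  A : Holomorphic D → Holomorphic D → Holomorphic D
  A u f = u ⊛ differentiate f

  A^ : ℕ → Holomorphic D → Holomorphic D → Holomorphic D
  A^ k u f = fold f (A u) k

∑ : ∀ {I : Set} → List I → (I → ℂ) → ℂ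
∑ is t = foldr _+_ 0# (map t is)

[1⋯_] : ℕ → List ℕ
[1⋯ n ] = applyUpTo suc n

-- ∑ i αᵢ for α = (α₁ , … , αₛ)
weight : ∀ {s} → Vec ℕ s → ℕ
weight α = Vec.sum (Vec.zipWith ℕ._*_ (Vec.tabulate λ i → suc (toℕ i)) α)

vectors : (s b : ℕ) → List (Vec ℕ s)
vectors zero    b = [ [] ]
vectors (suc s) b = cartesianProductWith _∷_ (upTo (suc b)) (vectors s b)

-- All α with ∑ αᵢ = m and ∑ i αᵢ = s, each once; the first equation forces αᵢ ≤ m.
indices : (s m : ℕ) → List (Vec ℕ s)
indices s m = filter (λ α → (Vec.sum α ℕ.≟ m) ×-dec (weight α ℕ.≟ s)) (vectors s m)

-- The candidate number C^{s,m,k}_{α₁,…,αₛ} is c k s m α; only its values at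
-- 1 ≤ s < k, 1 ≤ m ≤ s and α ∈ indices s m are constrained below.
Coefficients : Set
Coefficients = (k s m : ℕ) → Vec ℕ s → ℂ

-- ∏ (u⁽ⁱ⁾(z))^αᵢ over i = 1 , … , s
monomial : ∀ {D} (u : Holomorphic D) (z : ℂ) → D z → ∀ {s} → Vec ℕ s → ℂ
monomial u z z∈D α =
  Vec.foldr′ _*_ 1# (Vec.tabulate λ i → derivative u (suc (toℕ i)) z z∈D ^ Vec.lookup α i)

expansion : ∀ {D} → Coefficients → ℕ → (u f : Holomorphic D) (z : ℂ) → D z → ℂ
expansion c k u f z z∈D =
  u⁽z⁾ ^ k * f⁽ k ⁾ +
  ∑ [1⋯ k ℕ.∸ 1 ] λ s →
    (∑ [1⋯ s ] λ m →
      u⁽z⁾ ^ (k ℕ.∸ m) * (∑ (indices s m) λ α → c k s m α * monomial u z z∈D α))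
    * f⁽ k ℕ.∸ s ⁾
  where
  u⁽z⁾ : ℂ
  u⁽z⁾ = derivative u 0 z z∈D
  f⁽_⁾ : ℕ → ℂ
  f⁽ n ⁾ = derivative f n z z∈D

ExpandsPower : ∀ {D} → Coefficients → ℕ → Holomorphic D → Holomorphic D → Set
ExpandsPower {D} c k u f =
  ∀ z (z∈D : D z) → derivative (A^ k u f) 0 z z∈D ≈ expansion c k u f z z∈D

-- c satisfies the defining property of the numbers C: the expansion of Aᵏ, as an
-- identity of operators, holds with the same c for every entire or meromorphic u.
Universal : Coefficients → Set₁
Universal c = ∀ k → 1 ℕ.≤ k →
  ((u f : Entire) → ExpandsPower c k u f) ×
  ((u f : Meromorphic) → ExpandsPower {λ z → domain u z × domain f z} c k
    (restrict (λ _ → proj₁) (function u)) (restrict (λ _ → proj₂) (function f)))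

{-# OPTIONS --safe #-}
module Submission where

-- Evaluate the expansion of A^(k+1) at z = 0 for u = 1 + zˢ/s! and f = zⁿ/n!, where s = t + 1
-- and n = k + 1 − s.  All derivatives of u and f at 0 vanish except u(0) = u⁽ˢ⁾(0) = f⁽ⁿ⁾(0) = 1,
-- so on the right only C^{s,1,k+1}_{0,…,0,1} survives.  On the left, write φ j m for the value
-- at 0 of Aʲ applied to zᵐ/m!.  Since
--   A (zᵐ⁺¹/(m+1)!) = zᵐ/m! + binom(s+m, s) zˢ⁺ᵐ/(s+m)!,
-- one has φ (j+1) (m+1) = φ j m + binom(s+m, s) φ j (s+m), whence φ j m = 0 for m > j,
-- φ j j = 1, and, by Pascal's rule, φ (s+m) m = binom(s+m, s+1).

open import Algebra.Bundles using (CommutativeRing; CommutativeSemiring)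
import Algebra.Properties.CommutativeMonoid.Mult as CommutativeMonoidMult
import Algebra.Properties.CommutativeSemigroup as CommutativeSemigroupProperties
import Algebra.Properties.Semiring.Exp as SemiringExp
import Algebra.Properties.Semiring.Mult as SemiringMult
open import Data.Fin.Base using (toℕ)
open import Data.List.Base using ([]; _∷_)
open import Data.List.Membership.Propositional using (_∈_)
open import Data.List.Membership.Propositional.Properties
  using (∈-filter⁺; ∈-filter⁻; ∈-cartesianProductWith⁺; ∈-upTo⁺; ∈-applyUpTo⁺; ∈-applyUpTo⁻)
open import Data.List.Relation.Unary.All using ([]; lookup)
open import Data.List.Relation.Unary.AllPairs using ([]; _∷_)
open import Data.List.Relation.Unary.Any using (here; there)
open import Data.List.Relation.Unary.Unique.Propositional using (Unique)
open import Data.List.Relation.Unary.Unique.Propositional.Properties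
  using (filter⁺; cartesianProductWith⁺; upTo⁺; applyUpTo⁺₁)
open import Data.Nat.Base as ℕ using (ℕ; zero; suc; _≤_; _<_; s≤s; z≤n; _∸_)
open import Data.Nat.Combinatorics using (_C_; nCn≡1; k>n⇒nCk≡0; nCk+nC[k+1]≡[n+1]C[k+1])
import Data.Nat.Properties as ℕ
open import Data.Product.Base using (_×_; _,_; ∃-syntax; proj₁; proj₂)
open import Data.Rational.Base as ℚ using (ℚ; 0ℚ; 1ℚ)
import Data.Rational.Properties as ℚ
import Data.Rational.Solver as ℚ-Solver
open import Data.Sum.Base using (_⊎_; inj₁; inj₂)
open import Data.Unit.Base using (tt)
open import Data.Vec.Base as Vec using (Vec; []; _∷_; replicate; _∷ʳ_)
import Data.Vec.Properties as Vec
open import Function.Base using (_∘_)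
import Relation.Binary.Reasoning.Setoid as SetoidReasoning
open import Relation.Binary.PropositionalEquality as ≡ using (_≡_; _≢_)
open import Relation.Nullary.Decidable using (_×-dec_)
open import Relation.Nullary.Negation using (contradiction)

-- Formal jets, their Leibniz product and the iterates of u d/dz.

module Jets {c ℓ} (R : CommutativeSemiring c ℓ) where

  open CommutativeSemiring R
  open SemiringMult semiring
    using (×-congʳ; ×-homo-1; ×-homo-+; ×-comm-*)
    renaming (_×_ to infixr 8 _·_)
  open CommutativeMonoidMult +-commutativeMonoid using (×-distrib-+)
  open CommutativeSemigroupProperties +-commutativeSemigroup using (interchange)
  open SetoidReasoning setoid

  ·-vanish : ∀ a {x} → x ≈ 0# → a · x ≈ 0#
  ·-vanish zero    x≈0 = refl
  ·-vanish (suc a) x≈0 = trans (+-cong x≈0 (·-vanish a x≈0)) (+-identityˡ 0#)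

  Jet : Set c
  Jet = ℕ → Carrier

  -- The recursion on both arguments makes `δ (suc m) ∘ suc` compute to `δ m` and `δ 0 ∘ suc` to the
  -- zero jet, so differentiating a divided power needs no rewriting.
  δ : ℕ → Jet
  δ zero    zero    = 1#
  δ zero    (suc n) = 0#
  δ (suc m) zero    = 0#
  δ (suc m) (suc n) = δ m n

  δ-diag : ∀ m → δ m m ≈ 1#
  δ-diag zero    = refl
  δ-diag (suc m) = δ-diag m

  δ-off : ∀ {m n} → m ≢ n → δ m n ≈ 0#
  δ-off {zero}  {zero}  m≢n = contradiction ≡.refl m≢n
  δ-off {zero}  {suc n} m≢n = refl
  δ-off {suc m} {zero}  m≢n = refl
  δ-off {suc m} {suc n} m≢n = δ-off (m≢n ∘ ≡.cong suc)

  -- The product of exponential generating series. It follows the recursion of `productDerivative`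
  -- rather than the binomial sum, so that the two agree by a direct induction.
  leibniz : Jet → Jet → Jet
  leibniz F G zero    = F 0 * G 0
  leibniz F G (suc n) = leibniz (F ∘ suc) G n + leibniz F (G ∘ suc) n

  leibniz-cong : ∀ {F F′ G G′} → (∀ n → F n ≈ F′ n) → (∀ n → G n ≈ G′ n) →
                 ∀ n → leibniz F G n ≈ leibniz F′ G′ n
  leibniz-cong F≈ G≈ zero    = *-cong (F≈ 0) (G≈ 0)
  leibniz-cong F≈ G≈ (suc n) =
    +-cong (leibniz-cong (F≈ ∘ suc) G≈ n) (leibniz-cong F≈ (G≈ ∘ suc) n)

  leibniz-comm : ∀ F G n → leibniz F G n ≈ leibniz G F n
  leibniz-comm F G zero    = *-comm (F 0) (G 0)
  leibniz-comm F G (suc n) = trans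
    (+-cong (leibniz-comm (F ∘ suc) G n) (leibniz-comm F (G ∘ suc) n)) (+-comm _ _)

  leibniz-zeroʳ : ∀ F n → leibniz F (λ _ → 0#) n ≈ 0#
  leibniz-zeroʳ F zero    = zeroʳ (F 0)
  leibniz-zeroʳ F (suc n) = trans
    (+-cong (leibniz-zeroʳ (F ∘ suc) n) (leibniz-zeroʳ F n)) (+-identityˡ 0#)

  leibniz-linearʳ : ∀ F G a H n → leibniz F (λ i → G i + a · H i) n ≈
                    leibniz F G n + a · leibniz F H n
  leibniz-linearʳ F G a H zero    =
    trans (distribˡ (F 0) (G 0) (a · H 0)) (+-congˡ (×-comm-* a (F 0) (H 0)))
  leibniz-linearʳ F G a H (suc n) = begin
    leibniz (F ∘ suc) (λ i → G i + a · H i) n + leibniz F (λ i → G (suc i) + a · H (suc i)) n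
      ≈⟨ +-cong (leibniz-linearʳ (F ∘ suc) G a H n) (leibniz-linearʳ F (G ∘ suc) a (H ∘ suc) n) ⟩
    (leibniz (F ∘ suc) G n + a · leibniz (F ∘ suc) H n) +
    (leibniz F (G ∘ suc) n + a · leibniz F (H ∘ suc) n)
      ≈⟨ interchange _ _ _ _ ⟩
    leibniz F G (suc n) + (a · leibniz (F ∘ suc) H n + a · leibniz F (H ∘ suc) n)
      ≈⟨ +-congˡ (×-distrib-+ _ _ a) ⟨
    leibniz F G (suc n) + a · leibniz F H (suc n) ∎

  leibniz-distribʳ : ∀ F G H n → leibniz (λ i → F i + G i) H n ≈ leibniz F H n + leibniz G H n
  leibniz-distribʳ F G H zero    = distribʳ (H 0) (F 0) (G 0)
  leibniz-distribʳ F G H (suc n) = trans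
    (+-cong (leibniz-distribʳ (F ∘ suc) (G ∘ suc) H n) (leibniz-distribʳ F G (H ∘ suc) n))
    (interchange _ _ _ _)

  leibniz-identityˡ : ∀ G n → leibniz (δ 0) G n ≈ G n
  leibniz-identityˡ G zero    = *-identityˡ (G 0)
  leibniz-identityˡ G (suc n) = trans
    (+-cong (trans (leibniz-comm (λ _ → 0#) G n) (leibniz-zeroʳ G n)) (leibniz-identityˡ (G ∘ suc) n))
    (+-identityˡ _)

  -- The divided powers xᵐ/m!, whose jets at 0 are the δ m, multiply with binomial coefficients.
  leibniz-δ : ∀ s m n → leibniz (δ s) (δ m) n ≈ ((s ℕ.+ m) C s) · δ (s ℕ.+ m) n
  leibniz-δ zero    m       n       = trans (leibniz-identityˡ (δ m) n) (sym (×-homo-1 _))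
  leibniz-δ (suc s) zero    n       = begin
    leibniz (δ (suc s)) (δ 0) n  ≈⟨ leibniz-comm (δ (suc s)) (δ 0) n ⟩
    leibniz (δ 0) (δ (suc s)) n  ≈⟨ leibniz-identityˡ (δ (suc s)) n ⟩
    δ (suc s) n                  ≈⟨ ×-homo-1 _ ⟨
    1 · δ (suc s) n              ≡⟨ ≡.cong₂ (λ a b → a · δ b n) eq (≡.sym (ℕ.+-identityʳ (suc s))) ⟩
    ((suc s ℕ.+ 0) C suc s) · δ (suc s ℕ.+ 0) n ∎
    where
    eq : 1 ≡ (suc s ℕ.+ 0) C suc s
    eq = ≡.trans (≡.sym (nCn≡1 (suc s))) (≡.cong (_C suc s) (≡.sym (ℕ.+-identityʳ (suc s))))
  leibniz-δ (suc s) (suc m) zero    = trans (zeroˡ 0#) (sym (·-vanish ((suc s ℕ.+ suc m) C suc s) refl))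
  leibniz-δ (suc s) (suc m) (suc n) = begin
    leibniz (δ s) (δ (suc m)) n + leibniz (δ (suc s)) (δ m) n
      ≈⟨ +-cong (leibniz-δ s (suc m) n) (leibniz-δ (suc s) m n) ⟩
    (N C s) · δ N n + ((suc s ℕ.+ m) C suc s) · δ (suc s ℕ.+ m) n
      ≡⟨ ≡.cong (λ i → (N C s) · δ N n + (i C suc s) · δ i n) (≡.sym (ℕ.+-suc s m)) ⟩
    (N C s) · δ N n + (N C suc s) · δ N n
      ≈⟨ ×-homo-+ (δ N n) (N C s) (N C suc s) ⟨
    (N C s ℕ.+ N C suc s) · δ N n
      ≡⟨ ≡.cong (_· δ N n) (nCk+nC[k+1]≡[n+1]C[k+1] N s) ⟩
    (suc N C suc s) · δ N n ∎
    where N = s ℕ.+ suc m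

  -- If U and F are the jets of u and f at z, then Φ U k F is the value at z of (u d/dz)ᵏ f.
  Φ : Jet → ℕ → Jet → Carrier
  Φ U zero    F = F 0
  Φ U (suc k) F = Φ U k (leibniz U (F ∘ suc))

  module _ (U : Jet) where

    Φ-cong : ∀ k {F G} → (∀ n → F n ≈ G n) → Φ U k F ≈ Φ U k G
    Φ-cong zero    F≈G = F≈G 0
    Φ-cong (suc k) F≈G = Φ-cong k (leibniz-cong (λ _ → refl) (F≈G ∘ suc))

    Φ-zero : ∀ k → Φ U k (λ _ → 0#) ≈ 0#
    Φ-zero zero    = refl
    Φ-zero (suc k) = trans (Φ-cong k (leibniz-zeroʳ U)) (Φ-zero k)

    Φ-linear : ∀ k F a G → Φ U k (λ n → F n + a · G n) ≈ Φ U k F + a · Φ U k G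
    Φ-linear zero    F a G = refl
    Φ-linear (suc k) F a G = trans
      (Φ-cong k (leibniz-linearʳ U (F ∘ suc) a (G ∘ suc)))
      (Φ-linear k (leibniz U (F ∘ suc)) a (leibniz U (G ∘ suc)))

  module _ (t : ℕ) where

    private
      s = suc t

    1+δ : Jet
    1+δ n = δ 0 n + δ s n

    private
      Ψ = Φ 1+δ

    -- The innermost d/dz turns `δ (suc m)` into `δ m`; multiplying by 1 keeps it, multiplying by
    -- zˢ/s! moves it to degree s + m, and the remaining operators are linear.
    Φ-step : ∀ k m → Ψ (suc k) (δ (suc m)) ≈ Ψ k (δ m) + ((s ℕ.+ m) C s) · Ψ k (δ (s ℕ.+ m))
    Φ-step k m = trans
      (Φ-cong 1+δ k λ n → trans (leibniz-distribʳ (δ 0) (δ s) (δ m) n)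
        (+-cong (leibniz-identityˡ (δ m) n) (leibniz-δ s m n)))
      (Φ-linear 1+δ k (δ m) ((s ℕ.+ m) C s) (δ (s ℕ.+ m)))

    -- Each application lowers the order of vanishing at 0 by at most one.
    Φ-above : ∀ k m → k < m → Ψ k (δ m) ≈ 0#
    Φ-above zero    (suc m) _         = refl
    Φ-above (suc k) (suc m) (s≤s k<m) = trans (Φ-step k m) (trans
      (+-cong (Φ-above k m k<m)
              (·-vanish ((s ℕ.+ m) C s) (Φ-above k (s ℕ.+ m) (ℕ.<-≤-trans k<m (ℕ.m≤n+m m s)))))
      (+-identityˡ 0#))

    -- Only the constant term of 1 + zˢ/s! contributes: using zˢ once raises the degree above the
    -- number of applications left, because s is positive, and `Φ-above` gives 0.
    Φ-diag : ∀ k → Ψ k (δ k) ≈ 1#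
    Φ-diag zero    = refl
    Φ-diag (suc k) = trans (Φ-step k k) (trans
      (+-cong (Φ-diag k) (·-vanish ((s ℕ.+ k) C s) (Φ-above k (s ℕ.+ k) (ℕ.m<n+m k (s≤s ℕ.z≤n)))))
      (+-identityʳ 1#))

    -- Bringing degree m down to 0 in s + m applications uses the term zˢ/s! exactly once. In the
    -- induction it is used either in the innermost application, which leaves `Φ-diag`, or later,
    -- which leaves the previous case.
    Φ-binomial : ∀ m → Ψ (s ℕ.+ m) (δ m) ≈ ((s ℕ.+ m) C suc s) · 1#
    -- The first d/dz kills the constant `δ 0`, and the binomial coefficient of s over s + 1 is 0 as
    -- well.
    Φ-binomial zero    = trans (Φ-cong 1+δ (t ℕ.+ 0) (leibniz-zeroʳ 1+δ)) (trans
      (Φ-zero 1+δ (t ℕ.+ 0))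
      (reflexive (≡.cong (_· 1#) (≡.sym (k>n⇒nCk≡0 (s≤s (ℕ.≤-reflexive (ℕ.+-identityʳ s))))))))
    Φ-binomial (suc m) = begin
      Ψ (s ℕ.+ suc m) (δ (suc m))
        ≡⟨ ≡.cong (λ k → Ψ k (δ (suc m))) (ℕ.+-suc s m) ⟩
      Ψ (suc k) (δ (suc m))
        ≈⟨ Φ-step k m ⟩
      Ψ k (δ m) + (k C s) · Ψ k (δ k)
        ≈⟨ +-cong (Φ-binomial m) (×-congʳ (k C s) (Φ-diag k)) ⟩
      (k C suc s) · 1# + (k C s) · 1#
        ≈⟨ +-comm _ _ ⟩
      (k C s) · 1# + (k C suc s) · 1#
        ≈⟨ ×-homo-+ 1# (k C s) (k C suc s) ⟨
      (k C s ℕ.+ k C suc s) · 1#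
        ≡⟨ ≡.cong (_· 1#) (nCk+nC[k+1]≡[n+1]C[k+1] k s) ⟩
      (suc k C suc s) · 1#
        ≡⟨ ≡.cong (λ i → (i C suc s) · 1#) (≡.sym (ℕ.+-suc s m)) ⟩
      ((s ℕ.+ suc m) C suc s) · 1# ∎
      where k = s ℕ.+ m

open import Defs

open CommutativeRing ℂ-commutativeRing
  using (setoid; refl; sym; trans; reflexive; semiring; commutativeSemiring;
         +-cong; +-congˡ; +-congʳ; +-identityˡ; +-identityʳ; -‿cong; -‿inverseʳ;
         *-cong; *-congˡ; *-congʳ; *-assoc; *-comm; *-identityˡ; *-identityʳ;
         distribʳ; zeroˡ; zeroʳ)
open SemiringExp semiring using (^-congˡ)
open SetoidReasoning setoid
open Jets commutativeSemiring

-- Finite sums, index vectors and their monomials.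

1^n≈1 : ∀ n → 1# ^ n ≈ 1#
1^n≈1 zero    = refl
1^n≈1 (suc n) = trans (*-identityˡ _) (1^n≈1 n)

module _ {I : Set} {term : I → ℂ} where

  ∑-zero : ∀ {is} → (∀ {i} → i ∈ is → term i ≈ 0#) → ∑ is term ≈ 0#
  ∑-zero {[]}     vanish = refl
  ∑-zero {i ∷ is} vanish =
    trans (+-cong (vanish (here ≡.refl)) (∑-zero (vanish ∘ there))) (+-identityˡ 0#)

  -- Uniqueness ensures that the surviving index is counted only once; this is why the index lists
  -- are shown below to have no repetitions.
  ∑-single : ∀ {is i} → Unique is → i ∈ is → (∀ {j} → j ∈ is → j ≢ i → term j ≈ 0#) →
             ∑ is term ≈ term i
  ∑-single (i∉is ∷ _) (here ≡.refl) vanish = trans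
    (+-congˡ (∑-zero λ j∈is → vanish (there j∈is) λ j≡i → lookup i∉is j∈is (≡.sym j≡i)))
    (+-identityʳ _)
  ∑-single (j∉is ∷ is!) (there i∈is) vanish = trans
    (+-cong (vanish (here ≡.refl) (lookup j∉is i∈is)) (∑-single is! i∈is (vanish ∘ there)))
    (+-identityˡ _)

[1⋯]-unique : ∀ n → Unique [1⋯ n ]
[1⋯]-unique n = applyUpTo⁺₁ suc n λ i<j _ → ℕ.<⇒≢ (s≤s i<j)

∈-[1⋯]⁻ : ∀ {n i} → i ∈ [1⋯ n ] → i ≤ n
∈-[1⋯]⁻ i∈ with ∈-applyUpTo⁻ suc i∈
... | _ , i<n , ≡.refl = i<n

vectors-unique : ∀ s b → Unique (vectors s b)
vectors-unique zero    b = [] ∷ []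
vectors-unique (suc s) b =
  cartesianProductWith⁺ _∷_ Vec.∷-injective (upTo⁺ (suc b)) (vectors-unique s b)

indices-unique : ∀ s m → Unique (indices s m)
indices-unique s m = filter⁺ _ (vectors-unique s m)

∈-indices⁻ : ∀ {s m α} → α ∈ indices s m → Vec.sum α ≡ m × weight α ≡ s
∈-indices⁻ {s} {m} α∈ =
  proj₂ (∈-filter⁻ (λ α → (Vec.sum α ℕ.≟ m) ×-dec (weight α ℕ.≟ s)) {xs = vectors s m} α∈)

-- The last entry is left general: vanishing of the lower derivatives only forces support in the
-- last place, and the weight then determines the entry.
unit : ∀ t → ℕ → Vec ℕ (suc t)
unit t x = replicate t 0 ∷ʳ x

sum-unit : ∀ t x → Vec.sum (unit t x) ≡ x
sum-unit zero    x = ℕ.+-identityʳ x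
sum-unit (suc t) x = sum-unit t x

weight-unit : ∀ t x → weight (unit t x) ≡ suc t ℕ.* x
weight-unit = go suc
  where
  weighted : ∀ {s} → (ℕ → ℕ) → Vec ℕ s → ℕ
  weighted w α = Vec.sum (Vec.zipWith ℕ._*_ (Vec.tabulate λ i → w (toℕ i)) α)

  -- Removing the leading entry shifts the weights, so the induction carries an arbitrary weight
  -- function.
  go : ∀ w t x → weighted w (unit t x) ≡ w t ℕ.* x
  go w zero    x = ℕ.+-identityʳ _
  go w (suc t) x = ≡.trans (≡.cong (ℕ._+ weighted (w ∘ suc) (unit t x)) (ℕ.*-zeroʳ (w 0)))
                           (go (w ∘ suc) t x)

unit∈vectors : ∀ t → unit t 1 ∈ vectors (suc t) 1
unit∈vectors zero    = there (here ≡.refl)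
unit∈vectors (suc t) =
  ∈-cartesianProductWith⁺ _∷_ (∈-upTo⁺ {2} (s≤s z≤n)) (unit∈vectors t)

unit∈indices : ∀ t → unit t 1 ∈ indices (suc t) 1
unit∈indices t =
  ∈-filter⁺ _ (unit∈vectors t) (sum-unit t 1 , ≡.trans (weight-unit t 1) (ℕ.*-identityʳ (suc t)))

-- This is `monomial` with the derivatives of u replaced by any sequence, which can be shifted in an
-- induction on the vector.
powers : ∀ {s} → (ℕ → ℂ) → Vec ℕ s → ℂ
powers d α = Vec.foldr′ _*_ 1# (Vec.tabulate λ i → d (toℕ i) ^ Vec.lookup α i)

powers-unit : ∀ t d → powers d (unit t 1) ≈ d t
powers-unit zero    d = trans (*-identityʳ _) (*-identityʳ (d 0))
powers-unit (suc t) d = trans (*-identityˡ _) (powers-unit t (d ∘ suc))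

-- A nonzero entry before the last place contributes a positive power of some `d i` that is 0;
-- without such an entry the vector is some `unit t x`.
powers-vanish : ∀ t d → (∀ {i} → i < t → d i ≈ 0#) → (α : Vec ℕ (suc t)) →
                (∃[ x ] α ≡ unit t x) ⊎ powers d α ≈ 0#
powers-vanish zero    d d≈0 (x ∷ [])    = inj₁ (x , ≡.refl)
powers-vanish (suc t) d d≈0 (zero ∷ α)  with powers-vanish t (d ∘ suc) (d≈0 ∘ s≤s) α
... | inj₁ (x , ≡.refl) = inj₁ (x , ≡.refl)
... | inj₂ α≈0          = inj₂ (trans (*-identityˡ _) α≈0)
powers-vanish (suc t) d d≈0 (suc x ∷ α) = inj₂
  (trans (*-congʳ {powers (d ∘ suc) α} (trans (*-congʳ {d 0 ^ x} (d≈0 (s≤s z≤n))) (zeroˡ (d 0 ^ x))))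
         (zeroˡ (powers (d ∘ suc) α)))

-- Collapse of the expansion at a point to a single coefficient.

module _ {D : Domain} {u : Holomorphic D} {z : ℂ} {z∈D : D z} {t : ℕ}
         (u⁽i⁾≈0 : ∀ {i} → i < t → derivative u (suc i) z z∈D ≈ 0#) where

  -- By `powers-vanish` only `unit t x` could survive, and its weight (t + 1) x must equal t + 1, so
  -- x = 1.
  monomial-vanish : ∀ {m α} → α ∈ indices (suc t) m → α ≢ unit t 1 → monomial u z z∈D α ≈ 0#
  monomial-vanish {m} {α} α∈ α≢ with powers-vanish t (λ i → derivative u (suc i) z z∈D) u⁽i⁾≈0 α
  ... | inj₂ α≈0          = α≈0
  ... | inj₁ (x , ≡.refl) = contradiction (≡.cong (unit t) x≡1) α≢
    where
    weight≡ : weight (unit t x) ≡ suc t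
    weight≡ = proj₂ (∈-indices⁻ {m = m} α∈)
    x≡1 : x ≡ 1
    x≡1 = ℕ.*-cancelˡ-≡ x 1 (suc t)
      (≡.trans (≡.sym (weight-unit t x)) (≡.trans weight≡ (≡.sym (ℕ.*-identityʳ (suc t)))))

  module _ (c : Coefficients) (k : ℕ) (f : Holomorphic D) (t<k : t < k)
           (u≈1 : derivative u 0 z z∈D ≈ 1#) (u⁽s⁾≈1 : derivative u (suc t) z z∈D ≈ 1#)
           (f≈δ : ∀ j → derivative f j z z∈D ≈ δ (k ∸ t) j) where

    private
      C = c (suc k) (suc t) 1 (unit t 1)

      α-term : ∀ s m → Vec ℕ s → ℂ
      α-term s m α = c (suc k) s m α * monomial u z z∈D α

      m-term : ℕ → ℕ → ℂ
      m-term s m = derivative u 0 z z∈D ^ (suc k ∸ m) * ∑ (indices s m) (α-term s m)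

      s-term : ℕ → ℂ
      s-term s = ∑ [1⋯ s ] (m-term s) * derivative f (suc k ∸ s) z z∈D

    α-vanish : ∀ m {α} → α ∈ indices (suc t) m → α ≢ unit t 1 → α-term (suc t) m α ≈ 0#
    α-vanish m {α} α∈ α≢ =
      trans (*-congˡ {c (suc k) (suc t) m α} (monomial-vanish {m} α∈ α≢)) (zeroʳ (c (suc k) (suc t) m α))

    ∑α≈C : ∑ (indices (suc t) 1) (α-term (suc t) 1) ≈ C
    ∑α≈C = begin
      ∑ (indices (suc t) 1) (α-term (suc t) 1)
        ≈⟨ ∑-single {term = α-term (suc t) 1} (indices-unique (suc t) 1) (unit∈indices t) (α-vanish 1) ⟩
      C * monomial u z z∈D (unit t 1)
        ≈⟨ *-congˡ {C} (trans (powers-unit t λ i → derivative u (suc i) z z∈D) u⁽s⁾≈1) ⟩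
      C * 1#
        ≈⟨ *-identityʳ C ⟩
      C ∎

    -- The entries of `unit t 1` sum to 1, so this vector is not an index for any other m.
    m-vanish : ∀ {m} → m ∈ [1⋯ suc t ] → m ≢ 1 → m-term (suc t) m ≈ 0#
    m-vanish {m} _ m≢1 = trans
      (*-congˡ {derivative u 0 z z∈D ^ (suc k ∸ m)} (∑-zero {term = α-term (suc t) m} λ α∈ →
        α-vanish m α∈ λ { ≡.refl →
          m≢1 (≡.trans (≡.sym (proj₁ (∈-indices⁻ {m = m} α∈))) (sum-unit t 1)) }))
      (zeroʳ (derivative u 0 z z∈D ^ (suc k ∸ m)))

    ∑m≈C : ∑ [1⋯ suc t ] (m-term (suc t)) ≈ C
    ∑m≈C = begin
      ∑ [1⋯ suc t ] (m-term (suc t))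
        ≈⟨ ∑-single {term = m-term (suc t)} ([1⋯]-unique (suc t)) (here ≡.refl) m-vanish ⟩
      m-term (suc t) 1
        ≈⟨ *-cong (trans (^-congˡ k u≈1) (1^n≈1 k)) ∑α≈C ⟩
      1# * C
        ≈⟨ *-identityˡ C ⟩
      C ∎

    f-vanish : ∀ a j → k ∸ t ≢ j → a * derivative f j z z∈D ≈ 0#
    f-vanish a j ≢j = trans (*-congˡ {a} (trans (f≈δ j) (δ-off ≢j))) (zeroʳ a)

    s-vanish : ∀ {s} → s ∈ [1⋯ k ] → s ≢ suc t → s-term s ≈ 0#
    -- Subtraction from k + 1 is injective on numbers up to k + 1, so f⁽ᵏ⁺¹⁻ˢ⁾ has the surviving
    -- order k - t only for s = t + 1.
    s-vanish {s} s∈ s≢ = f-vanish (∑ [1⋯ s ] (m-term s)) (suc k ∸ s) λ eq →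
      s≢ (≡.sym (ℕ.∸-cancelˡ-≡ (s≤s (ℕ.<⇒≤ t<k)) (ℕ.m≤n⇒m≤1+n (∈-[1⋯]⁻ s∈)) eq))

    expansion-collapse : expansion c (suc k) u f z z∈D ≈ C
    expansion-collapse = begin
      derivative u 0 z z∈D ^ suc k * derivative f (suc k) z z∈D + ∑ [1⋯ k ] s-term
        ≈⟨ +-cong {derivative u 0 z z∈D ^ suc k * derivative f (suc k) z z∈D} {0#}
                  {∑ [1⋯ k ] s-term} {s-term (suc t)}
                  -- The leading term contains the derivative of f of order k + 1, which exceeds k -
                  -- t.
                  (f-vanish (derivative u 0 z z∈D ^ suc k) (suc k) (ℕ.<⇒≢ (s≤s (ℕ.m∸n≤m k t))))
                  (∑-single {term = s-term} ([1⋯]-unique k) (∈-applyUpTo⁺ suc t<k) s-vanish) ⟩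
      0# + s-term (suc t)
        ≈⟨ +-identityˡ (s-term (suc t)) ⟩
      ∑ [1⋯ suc t ] (m-term (suc t)) * derivative f (k ∸ t) z z∈D
        ≈⟨ *-cong {∑ [1⋯ suc t ] (m-term (suc t))} ∑m≈C (trans (f≈δ (k ∸ t)) (δ-diag (k ∸ t))) ⟩
      C * 1#
        ≈⟨ *-identityʳ C ⟩
      C ∎

-- From holomorphic functions to jets, and elementary differentiation rules.

module _ {D : Domain} where

  jet : Holomorphic D → ∀ z → D z → Jet
  jet f z z∈D n = derivative f n z z∈D

  productDerivative≡leibniz : ∀ (f g : Holomorphic D) n z (z∈D : D z) →
    productDerivative f g n z z∈D ≡ leibniz (jet f z z∈D) (jet g z z∈D) n
  productDerivative≡leibniz f g zero    z z∈D = ≡.refl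
  productDerivative≡leibniz f g (suc n) z z∈D = ≡.cong₂ _+_
    (productDerivative≡leibniz (differentiate f) g n z z∈D)
    (productDerivative≡leibniz f (differentiate g) n z z∈D)

  -- `A^` adds new factors on the outside, whereas `Φ` consumes the innermost factor first.
  A^-suc : ∀ k (u f : Holomorphic D) → A^ (suc k) u f ≡ A^ k u (A u f)
  A^-suc zero    u f = ≡.refl
  A^-suc (suc k) u f = ≡.cong (A u) (A^-suc k u f)

  -- The jet of `A u f` at z depends only on the jets of u and f at z, so the induction applies to
  -- `A u f` in place of f.
  A^≈Φ : ∀ k (u f : Holomorphic D) z (z∈D : D z) {U F} →
    (∀ n → jet u z z∈D n ≈ U n) → (∀ n → jet f z z∈D n ≈ F n) →
    derivative (A^ k u f) 0 z z∈D ≈ Φ U k F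
  A^≈Φ zero    u f z z∈D u≈U f≈F = f≈F 0
  A^≈Φ (suc k) u f z z∈D {U} {F} u≈U f≈F = trans
    (reflexive (≡.cong (λ g → derivative g 0 z z∈D) (A^-suc k u f)))
    (A^≈Φ k u (A u f) z z∈D u≈U λ n → trans
      (reflexive (productDerivative≡leibniz u (differentiate f) n z z∈D))
      (leibniz-cong u≈U (f≈F ∘ suc) n))

  infixl 6 _⊕_

  _⊕_ : Holomorphic D → Holomorphic D → Holomorphic D
  f ⊕ g = record
    { derivative   = λ n z z∈D → derivative f n z z∈D + derivative g n z z∈D
    ; isDerivative = λ n z z∈D → ProductRule.sum-rule z (derivative f n) (derivative g n) z∈D
        (derivative f (suc n) z z∈D) (derivative g (suc n) z z∈D)
        (isDerivative f n z z∈D) (isDerivative g n z z∈D)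
    }

  LittleO-zero : ∀ {z} {e : Fun D} → (∀ w w∈D → e w w∈D ≈ 0#) → LittleO {D} z e
  LittleO-zero {z} {e} e≈0 = ProductRule.o-cong z {λ _ _ → 0#} {e} (λ w d → sym (e≈0 w d))
    -- The zero error satisfies every bound, so any positive radius serves.
    λ ε 0<ε → 1ℚ , ℚ.positive⁻¹ 1ℚ , λ w _ _ → Real.pointwise-≤ λ n →
      *-nonneg (*-nonneg (ℚ.<⇒≤ 0<ε) (ℚ.<⇒≤ 0<ε)) (ProductRule.normSq-nonneg (w - z) n)

  constant-rule : ∀ a z z∈D → HasDerivativeAt {D} (λ _ _ → a) z z∈D 0#
  constant-rule a z z∈D = LittleO-zero λ w _ → begin
    (a - a) - 0# * (w - z)  ≈⟨ +-cong (-‿inverseʳ a) (-‿cong (zeroˡ (w - z))) ⟩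
    0# - 0#                 ≈⟨ -‿inverseʳ 0# ⟩
    0#                      ∎

  identity-rule : ∀ z z∈D → HasDerivativeAt {D} (λ w _ → w) z z∈D 1#
  identity-rule z z∈D = LittleO-zero λ w _ →
    trans (+-congˡ (-‿cong (*-identityˡ (w - z)))) (-‿inverseʳ (w - z))

  derivative-cong : ∀ (f : Fun D) z z∈D {c c′} → c ≈ c′ →
                    HasDerivativeAt {D} f z z∈D c → HasDerivativeAt {D} f z z∈D c′
  derivative-cong f z z∈D {c} {c′} c≈c′ = ProductRule.o-cong z
    {λ w d → (f w d - f z z∈D) - c * (w - z)} {λ w d → (f w d - f z z∈D) - c′ * (w - z)}
    λ w d → +-congˡ (-‿cong (*-congʳ c≈c′))

  scalar-rule : ∀ a (f : Fun D) z z∈D c → HasDerivativeAt {D} f z z∈D c →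
                HasDerivativeAt {D} (λ w d → a * f w d) z z∈D (a * c)
  scalar-rule a f z z∈D c h = derivative-cong (λ w d → a * f w d) z z∈D
    (trans (+-congʳ (zeroˡ _)) (+-identityˡ _))
    (ProductRule.product-rule z (λ _ _ → a) f z∈D 0# c (constant-rule a z z∈D) h)

-- Divided powers as holomorphic functions.

real : ℚ → ℂ
real q = Real.fromℚ q +i Real.0ℝ

-- The recursion matches that of `fromℕ`; passing through ℚ lets n + 1 be inverted there instead of
-- in ℂ.
natural : ℕ → ℚ
natural zero    = 0ℚ
natural (suc n) = 1ℚ ℚ.+ natural n

natural≥0 : ∀ n → 0ℚ ℚ.≤ natural n
natural≥0 zero    = ℚ.≤-refl
natural≥0 (suc n) = +-nonneg (ℚ.nonNegative⁻¹ 1ℚ) (natural≥0 n)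

natural-suc-nonZero : ∀ n → ℚ.NonZero (natural (suc n))
natural-suc-nonZero n = ℚ.pos⇒nonZero (natural (suc n))
  {{ℚ.positive (ℚ.+-mono-<-≤ (ℚ.positive⁻¹ 1ℚ) (natural≥0 n))}}

fromℕ≈real : ∀ n → fromℕ n ≈ real (natural n)
fromℕ≈real zero    = refl
fromℕ≈real (suc n) = trans (+-congˡ (fromℕ≈real n))
  (ℂ-Arithmetic.pointwise (λ _ → ≡.refl) (λ _ → ≡.refl))

real-* : ∀ p q → real p * real q ≈ real (p ℚ.* q)
real-* p q = ℂ-Arithmetic.pointwise
  (λ _ → solve 2 (λ p q → p :* q :+ :- (con 0ℚ :* con 0ℚ) := p :* q) ≡.refl p q)
  (λ _ → solve 2 (λ p q → p :* con 0ℚ :+ con 0ℚ :* q := con 0ℚ) ≡.refl p q)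
  where open ℚ-Solver.+-*-Solver

suc⁻¹ : ℕ → ℂ
suc⁻¹ n = real (ℚ.1/_ (natural (suc n)) {{natural-suc-nonZero n}})

suc⁻¹-inverse : ∀ n → suc⁻¹ n * fromℕ (suc n) ≈ 1#
suc⁻¹-inverse n = begin
  suc⁻¹ n * fromℕ (suc n)                ≈⟨ *-congˡ {suc⁻¹ n} (fromℕ≈real (suc n)) ⟩
  suc⁻¹ n * real (natural (suc n))       ≈⟨ real-* (ℚ.1/ q) q ⟩
  real (ℚ.1/ q ℚ.* q)                    ≡⟨ ≡.cong real (ℚ.*-inverseˡ q) ⟩
  1#                                     ∎
  where
  q = natural (suc n)
  instance _ = natural-suc-nonZero n

-- This is zᵐ/m!, normalised so that differentiation only lowers the index.
dividedPower : ℕ → ℂ → ℂ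
dividedPower zero    z = 1#
dividedPower (suc m) z = suc⁻¹ m * (z * dividedPower m z)

dividedPower⁽_⁾ : ℕ → ℕ → ℂ → ℂ
dividedPower⁽ zero  ⁾ m       = dividedPower m
dividedPower⁽ suc n ⁾ zero    = λ _ → 0#
dividedPower⁽ suc n ⁾ (suc m) = dividedPower⁽ n ⁾ m

-- Euler's relation for a homogeneous function of degree m; it supplies the term z p′ when the
-- product rule is applied to z p.
euler : ∀ m z → z * dividedPower⁽ 1 ⁾ m z ≈ fromℕ m * dividedPower m z
euler zero    z = trans (zeroʳ z) (sym (zeroˡ 1#))
euler (suc m) z = begin
  z * dividedPower m z                                    ≈⟨ *-identityˡ _ ⟨
  1# * (z * dividedPower m z)                             ≈⟨ *-congʳ {z * dividedPower m z} (suc⁻¹-inverse m) ⟨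
  (suc⁻¹ m * fromℕ (suc m)) * (z * dividedPower m z)      ≈⟨ *-congʳ {z * dividedPower m z} (*-comm (suc⁻¹ m) (fromℕ (suc m))) ⟩
  (fromℕ (suc m) * suc⁻¹ m) * (z * dividedPower m z)      ≈⟨ *-assoc (fromℕ (suc m)) (suc⁻¹ m) _ ⟩
  fromℕ (suc m) * dividedPower (suc m) z                  ∎

module _ {D : Domain} where

  -- Apart from constants and index shifts, the one case with content is the first derivative in
  -- degree m + 1. With P = zᵐ/m! the product rule gives (P + z P′)/(m + 1), and z P′ = m P by
  -- `euler`.
  dividedPower-rule : ∀ n m z z∈D → HasDerivativeAt {D} (λ w _ → dividedPower⁽ n ⁾ m w) z z∈D
                                      (dividedPower⁽ suc n ⁾ m z)
  dividedPower-rule zero    zero    z z∈D = constant-rule 1# z z∈D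
  dividedPower-rule (suc n) zero    z z∈D = constant-rule 0# z z∈D
  dividedPower-rule (suc n) (suc m) z z∈D = dividedPower-rule n m z z∈D
  dividedPower-rule zero    (suc m) z z∈D =
    derivative-cong (λ w _ → dividedPower (suc m) w) z z∈D value
      (scalar-rule (suc⁻¹ m) (λ w _ → w * dividedPower m w) z z∈D
        (1# * dividedPower m z + z * dividedPower⁽ 1 ⁾ m z)
        (ProductRule.product-rule z (λ w _ → w) (λ w _ → dividedPower m w) z∈D
          1# (dividedPower⁽ 1 ⁾ m z) (identity-rule z z∈D) (dividedPower-rule zero m z z∈D)))
    where
    P = dividedPower m z
    value : suc⁻¹ m * (1# * P + z * dividedPower⁽ 1 ⁾ m z) ≈ P
    value = begin
      suc⁻¹ m * (1# * P + z * dividedPower⁽ 1 ⁾ m z)  ≈⟨ *-congˡ {suc⁻¹ m} (+-congˡ {1# * P} (euler m z)) ⟩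
      suc⁻¹ m * (1# * P + fromℕ m * P)                ≈⟨ *-congˡ {suc⁻¹ m} (distribʳ P 1# (fromℕ m)) ⟨
      suc⁻¹ m * (fromℕ (suc m) * P)                   ≈⟨ *-assoc (suc⁻¹ m) (fromℕ (suc m)) P ⟨
      (suc⁻¹ m * fromℕ (suc m)) * P                   ≈⟨ *-congʳ {P} (suc⁻¹-inverse m) ⟩
      1# * P                                          ≈⟨ *-identityˡ P ⟩
      P                                               ∎

  dividedPowerᴴ : ℕ → Holomorphic D
  dividedPowerᴴ m = record
    { derivative   = λ n z _ → dividedPower⁽ n ⁾ m z
    ; isDerivative = λ n → dividedPower-rule n m
    }

dividedPower-jet : ∀ m n → dividedPower⁽ n ⁾ m 0# ≈ δ m n
dividedPower-jet zero    zero    = refl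
dividedPower-jet zero    (suc n) = refl
dividedPower-jet (suc m) zero    = trans
  (*-congˡ {suc⁻¹ m} (zeroˡ (dividedPower m 0#))) (zeroʳ (suc⁻¹ m))
dividedPower-jet (suc m) (suc n) = dividedPower-jet m n

-- Comparison of both sides for 1 + zˢ/s! and zᵏ⁻ᵗ/(k - t)!, with s = t + 1.

corollary3p1 : (c : Coefficients) → Universal c →
    ∀ k → 1 ≤ k → ∀ t → suc t ≤ k →
    c (suc k) (suc t) 1 (replicate t 0 ∷ʳ 1) ≈ fromℕ (suc k C suc (suc t))
corollary3p1 c universal k 1≤k t t<k = begin
  c (suc k) (suc t) 1 (unit t 1)
    ≈⟨ expansion-collapse {u = u} {z = 0#} u⁽i⁾≈0 c k f t<k u≈1 u⁽s⁾≈1 f≈δ ⟨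
  expansion c (suc k) u f 0# tt
    ≈⟨ proj₁ (universal (suc k) (s≤s z≤n)) u f 0# tt ⟨
  derivative (A^ (suc k) u f) 0 0# tt
    ≈⟨ A^≈Φ (suc k) u f 0# tt u≈1+δ f≈δ ⟩
  Φ (1+δ t) (suc k) (δ (k ∸ t))
    -- `Φ-binomial` counts applications as s + m; for s = t + 1 and m = k - t this is k + 1, since t
    -- is at most k.
    ≡⟨ ≡.cong (λ j → Φ (1+δ t) (suc j) (δ (k ∸ t))) (≡.sym t+[k∸t]≡k) ⟩
  Φ (1+δ t) (suc t ℕ.+ (k ∸ t)) (δ (k ∸ t))
    ≈⟨ Φ-binomial t (k ∸ t) ⟩
  fromℕ ((suc t ℕ.+ (k ∸ t)) C suc (suc t))
    ≡⟨ ≡.cong (λ j → fromℕ (suc j C suc (suc t))) t+[k∸t]≡k ⟩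
  fromℕ (suc k C suc (suc t)) ∎
  where
  u f : Entire
  u = dividedPowerᴴ 0 ⊕ dividedPowerᴴ (suc t)
  f = dividedPowerᴴ (k ∸ t)

  t+[k∸t]≡k : t ℕ.+ (k ∸ t) ≡ k
  t+[k∸t]≡k = ℕ.m+[n∸m]≡n (ℕ.<⇒≤ t<k)

  u≈1+δ : ∀ n → derivative u n 0# tt ≈ 1+δ t n
  u≈1+δ n = +-cong (dividedPower-jet 0 n) (dividedPower-jet (suc t) n)

  f≈δ : ∀ n → derivative f n 0# tt ≈ δ (k ∸ t) n
  f≈δ = dividedPower-jet (k ∸ t)

  u≈1 : derivative u 0 0# tt ≈ 1#
  u≈1 = trans (u≈1+δ 0) (+-identityʳ 1#)

  u⁽i⁾≈0 : ∀ {i} → i < t → derivative u (suc i) 0# tt ≈ 0#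
  u⁽i⁾≈0 {i} i<t = trans (u≈1+δ (suc i))
    (trans (+-identityˡ (δ t i)) (δ-off (ℕ.<⇒≢ i<t ∘ ≡.sym)))

  u⁽s⁾≈1 : derivative u (suc t) 0# tt ≈ 1#
  u⁽s⁾≈1 = trans (u≈1+δ (suc t)) (trans (+-identityˡ (δ t t)) (δ-diag t))
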